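{- Let $T$ be a singular weighted tree with $n$ vertices. The following statements are equivalent: (i) the number of alternating paths in $T$ is $n-1$; (ii) $T^{\#}$ is a tree; (iii) $T$ is a star; (iv) $T^{\#}$ is isomorphic to $T$.
   Context: A weighted tree is a tree with a nonzero real weight on each edge; it is singular if its adjacency matrix $A$ (entry $(i,j)$ equal to the weight of edge $v_iv_j$, or $0$ if no edge) is singular. The group inverse $A^{\#}$ is the unique matrix $X$ with $AXA=A$, $XAX=X$, $AX=XA$. The group inverse graph $T^{\#}$ is the weighted graph on the same vertex set in which $v_iv_j$ is an edge iff the $(i,j)$ entry of $A^{\#}$ is nonzero, weighted by that entry. Two weighted graphs are isomorphic if their underlying unweighted graphs are isomorphic. A matching is a set of pairwise vertex-disjoint edges; a maximum matching is one of maximum cardinality. A path is alternating with respect to a maximum matching $M$ if its edges lie alternately in $M$ and not in $M$, with first and last edges in $M$; an alternating path in $T$ means a path in $T$ that is alternating with respect to some maximum matching of $T$ (paths counted as subgraphs, i.e. by their pair of endpoints). -}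

module Defs where

open import Level using (0ℓ)
open import Data.Nat using (ℕ; zero; suc; _∸_) renaming (_≤_ to _≤ℕ_; _<_ to _<ℕ_)
open import Data.Fin using (Fin; toℕ) renaming (zero to fz; suc to fs)
open import Data.List using (List; []; _∷_; length; concatMap)
open import Data.List.Membership.Propositional using (_∈_)
open import Data.List.Relation.Unary.Unique.Propositional using (Unique)
open import Data.List.Relation.Unary.All using (All)
open import Data.Product using (Σ; ∃; ∃-syntax; _×_; _,_; proj₁; proj₂)
open import Data.Sum using (_⊎_)
open import Data.Empty using (⊥)
open import Relation.Nullary using (¬_)
open import Relation.Binary.PropositionalEquality using (_≡_)
open import Relation.Binary.Structures using (IsStrictTotalOrder)
open import Algebra.Structures using (IsCommutativeRing)
open import Function.Bundles using (_↔_; _⇔_; Inverse)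

-- The real numbers, axiomatised as a (Dedekind-)complete ordered field.
-- Every model is (classically) isomorphic to ℝ, so quantifying over all
-- models is the same as speaking about ℝ.

record Reals : Set₁ where
  infixl 6 _+_
  infixl 7 _*_
  infix 4 _<_ _≤_
  field
    ℝ : Set
    0ℝ 1ℝ : ℝ
    _+_ _*_ : ℝ → ℝ → ℝ
    -_ : ℝ → ℝ
    _<_ : ℝ → ℝ → Set
    isCommutativeRing : IsCommutativeRing _≡_ _+_ _*_ -_ 0ℝ 1ℝ
    0≢1 : ¬ (0ℝ ≡ 1ℝ)
    inverse : ∀ x → ¬ (x ≡ 0ℝ) → ∃[ y ] (x * y ≡ 1ℝ)
    isStrictTotalOrder : IsStrictTotalOrder _≡_ _<_
    +-mono-< : ∀ {x y} z → x < y → x + z < y + z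
    *-pos : ∀ {x y} → 0ℝ < x → 0ℝ < y → 0ℝ < x * y
  _≤_ : ℝ → ℝ → Set
  x ≤ y = x < y ⊎ x ≡ y
  field
    sup : (P : ℝ → Set) → ∃ P → (∃[ b ] (∀ x → P x → x ≤ b)) →
          ∃[ s ] ((∀ x → P x → x ≤ s) × (∀ b → (∀ x → P x → x ≤ b) → s ≤ b))

Graph : ℕ → Set₁
Graph n = Fin n → Fin n → Set

data Walk {n : ℕ} (G : Graph n) : Fin n → Fin n → List (Fin n) → Set where
  here : ∀ {v} → Walk G v v (v ∷ [])
  step : ∀ {u w v vs} → G u w → Walk G w v vs → Walk G u v (u ∷ vs)

IsPath : ∀ {n} → Graph n → Fin n → Fin n → List (Fin n) → Set
IsPath G u v vs = Walk G u v vs × Unique vs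

Connected : ∀ {n} → Graph n → Set
Connected {n} G = ∀ (u v : Fin n) → ∃[ vs ] Walk G u v vs

Acyclic : ∀ {n} → Graph n → Set
Acyclic {n} G = ∀ (u v : Fin n) (vs : List (Fin n)) →
  IsPath G u v vs → 3 ≤ℕ length vs → ¬ G v u

record IsTree {n : ℕ} (G : Graph n) : Set where
  field
    nonempty    : 1 ≤ℕ n
    symmetric   : ∀ i j → G i j → G j i
    irreflexive : ∀ i → ¬ G i i
    connected   : Connected G
    acyclic     : Acyclic G

-- A star: there is a centre vertex lying on every edge (K₁ counts as the
-- star K_{1,0}).
IsStar : ∀ {n} → Graph n → Set
IsStar {n} G = ∃[ c ] (∀ (i j : Fin n) → G i j → (i ≡ c ⊎ j ≡ c))

Isomorphic : ∀ {n} → Graph n → Graph n → Set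
Isomorphic {n} G H = Σ (Fin n ↔ Fin n) λ σ →
  ∀ i j → G i j ⇔ H (Inverse.to σ i) (Inverse.to σ j)

endpoints : ∀ {n} → List (Fin n × Fin n) → List (Fin n)
endpoints = concatMap (λ e → proj₁ e ∷ proj₂ e ∷ [])

IsMatching : ∀ {n} → Graph n → List (Fin n × Fin n) → Set
IsMatching G M = All (λ e → G (proj₁ e) (proj₂ e)) M × Unique (endpoints M)

IsMaximumMatching : ∀ {n} → Graph n → List (Fin n × Fin n) → Set
IsMaximumMatching G M = IsMatching G M ×
  (∀ M' → IsMatching G M' → length M' ≤ℕ length M)

InM : ∀ {n} → List (Fin n × Fin n) → Fin n → Fin n → Set
InM M a b = (a , b) ∈ M ⊎ (b , a) ∈ M

Alternates : ∀ {n} → List (Fin n × Fin n) → List (Fin n) → Set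
Alternates M (a ∷ b ∷ []) = InM M a b
Alternates M (a ∷ b ∷ c ∷ rest) = InM M a b × ¬ InM M b c × Alternates M (c ∷ rest)
Alternates M [] = ⊥
Alternates M (a ∷ []) = ⊥

AlternatingPathBetween : ∀ {n} → Graph n → Fin n → Fin n → Set
AlternatingPathBetween {n} G u v =
  ∃[ M ] ∃[ vs ] (IsMaximumMatching G M × IsPath G u v vs × Alternates M vs)

-- Paths are counted by their (unordered) pair of endpoints; we represent
-- the pair {u,v} by (u , v) with toℕ u < toℕ v.
-- "The number of alternating paths of G is k":
NumAlternatingPaths≡ : ∀ {n} → Graph n → ℕ → Set
NumAlternatingPaths≡ {n} G k = ∃[ ps ] (Unique ps × length ps ≡ k ×
  (∀ (u v : Fin n) → (u , v) ∈ ps ⇔ (toℕ u <ℕ toℕ v × AlternatingPathBetween G u v)))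

module _ (R : Reals) where
  open Reals R

  Mat : ℕ → Set
  Mat n = Fin n → Fin n → ℝ

  sumFin : ∀ {n} → (Fin n → ℝ) → ℝ
  sumFin {zero} f = 0ℝ
  sumFin {suc n} f = f fz + sumFin (λ i → f (fs i))

  _·_ : ∀ {n} → Mat n → Mat n → Mat n
  (A · B) i j = sumFin (λ k → A i k * B k j)

  _≐_ : ∀ {n} → Mat n → Mat n → Set
  A ≐ B = ∀ i j → A i j ≡ B i j

  idMat : ∀ {n} → Mat n
  idMat i j with i Data.Fin.≟ j
  ... | Relation.Nullary.yes _ = 1ℝ
  ... | Relation.Nullary.no _ = 0ℝ

  Singular : ∀ {n} → Mat n → Set
  Singular {n} A = ¬ (∃[ B ] ((A · B) ≐ idMat × (B · A) ≐ idMat))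

  IsGroupInverse : ∀ {n} → Mat n → Mat n → Set
  IsGroupInverse A X = ((A · X) · A) ≐ A × ((X · A) · X) ≐ X × (A · X) ≐ (X · A)

  graphOf : ∀ {n} → Mat n → Graph n
  graphOf A i j = ¬ (A i j ≡ 0ℝ)

  IsWeightedTree : ∀ {n} → Mat n → Set
  IsWeightedTree A = (∀ i j → A i j ≡ A j i) × IsTree (graphOf A)

{-# OPTIONS --safe #-}

-- Every condition is compared with "T is a star", using a vector z ≠ 0 with Az = 0.
--
-- Paths.  The alternating paths form a connected graph on the vertices.  T has no
-- perfect matching, for otherwise z would be supported on an infinite
-- non-backtracking ray.  So some maximum matching M misses a vertex u; let uv be an
-- edge and vw ∈ M.  If v has a neighbour x ≠ u, w covered by xy ∈ M, then the pairs
-- uv, vw, wy, yu are joined by alternating paths (for M or for M − vw + uv); if w has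
-- a neighbour t ≠ v, matched to t′, the same holds for vw, wt, tt′, t′v.  A connected
-- graph with a 4-cycle has at least n edges, so with n − 1 alternating paths neither
-- case occurs; exchanging edges at v then makes every neighbour of v a leaf.
--
-- Inverse.  Let P = AX = XA, which is the symmetric projection onto the range of A.
-- The support of z contains a leaf s of T, with neighbour v say; then
-- P s j = A s v X v j and P s s ∉ {0, 1}.  If X s j ≠ 0 with j ≠ v, then X = XP yields
-- i ≠ s with X j i ≠ 0 and P i s ≠ 0, hence X v i ≠ 0, and v s j i is a 4-cycle of T#.
-- If T# has no 4-cycle, s is therefore a leaf of T# too, and comparing the rows v of A
-- and X shows that T has no vertex at distance two from v.  Conversely, a star
-- satisfies A³ = qA, so A = qX.

module Submission where

open import Defs
open import Level using (0ℓ)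
open import Algebra.Bundles using (CommutativeRing)
open import Data.Nat using (ℕ; zero; suc; _∸_; z≤n; s≤s) renaming (_≤_ to _≤ℕ_; _<_ to _<ℕ_; _+_ to _+ℕ_)
import Data.Nat.Properties as ℕₚ
open import Data.Fin using (Fin; toℕ; punchIn) renaming (zero to fz; suc to fs)
open import Data.Fin.Properties
  using (_≟_; any?; all?; toℕ-injective; injective⇒≤; ¬∀⟶∃¬; punchIn-injective; punchInᵢ≢i; punchIn-punchOut)
open import Data.List using (List; []; _∷_; _++_; length; map; filter; lookup; allFin)
open import Data.List.Properties using (length-map; length-tabulate; filter-all; length-++-sucʳ)
open import Data.List.Membership.Propositional using (_∈_; _∉_)
open import Data.List.Membership.Propositional.Properties
  using (∈-map⁺; ∈-map⁻; ∈-∃++; ∈-++⁺ˡ; ∈-++⁺ʳ; ∈-++⁻; ∈-lookup; ∈-allFin; ∈-filter⁻)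
open import Data.List.Relation.Unary.Any using (here; there)
open import Data.List.Relation.Unary.All as All using (All; []; _∷_)
open import Data.List.Relation.Unary.All.Properties using (anti-mono; ¬Any⇒All¬; All¬⇒¬Any)
open import Data.List.Relation.Unary.AllPairs using ([]; _∷_)
open import Data.List.Relation.Unary.Unique.Propositional using (Unique)
open import Data.List.Relation.Unary.Unique.Propositional.Properties using (filter⁺; map⁺; allFin⁺)
open import Data.List.Relation.Binary.Subset.Propositional using (_⊆_)
open import Data.Product as × using (Σ; ∃-syntax; _×_; _,_; proj₁; proj₂)
open import Data.Sum as Sum using (_⊎_; inj₁; inj₂; swap)
open import Data.Empty using (⊥; ⊥-elim)
open import Relation.Nullary using (¬_; Dec; yes; no; ¬?; contradiction)
open import Relation.Nullary.Decidable using (_×-dec_; _→-dec_; _⊎-dec_; decidable-stable)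
open import Relation.Binary.Structures using (IsStrictTotalOrder)
open import Relation.Binary.Definitions using (tri<; tri≈; tri>)
open import Relation.Binary.PropositionalEquality
  using (_≡_; _≢_; refl; sym; trans; cong; cong₂; subst; module ≡-Reasoning)
open import Function.Base using (_∘_; id)
open import Function.Bundles using (_⇔_; mk⇔; Inverse; module Equivalence)
open import Function.Construct.Identity using (↔-id)

-- Pigeonhole for lists without repetition.

unique-length≤ : ∀ {n} {xs : List (Fin n)} → Unique xs → length xs ≤ℕ n
unique-length≤ uq = injective⇒≤ (lookup-injective uq _ _)
  where
  lookup-injective : ∀ {n} {xs : List (Fin n)} → Unique xs →
    ∀ i j → lookup xs i ≡ lookup xs j → i ≡ j
  lookup-injective (_ ∷ _)  fz     fz     _  = refl
  lookup-injective (x∉ ∷ _) fz     (fs j) eq = contradiction eq (All.lookup x∉ (∈-lookup j))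
  lookup-injective (x∉ ∷ _) (fs i) fz     eq = contradiction (sym eq) (All.lookup x∉ (∈-lookup i))
  lookup-injective (_ ∷ uq) (fs i) (fs j) eq = cong fs (lookup-injective uq i j eq)

-- Walks in trees

walk-head : ∀ {n} {G : Graph n} {u v w vs} → Walk G u v (w ∷ vs) → u ≡ w
walk-head here       = refl
walk-head (step _ _) = refl

walk-length : ∀ {n} {G : Graph n} {u v vs} → Walk G u v vs → 1 ≤ℕ length vs
walk-length here       = s≤s z≤n
walk-length (step _ _) = s≤s z≤n

-- The inclusion `ws ⊆ vs` is carried along because it is what keeps a vertex prepended to `ws`
-- fresh.
prefix : ∀ {n} {G : Graph n} {u v w vs} → IsPath G u v vs → w ∈ vs →
  ∃[ ws ] (IsPath G u w ws × ws ⊆ vs)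
prefix {vs = u ∷ _} (here , _)          (here refl) = u ∷ [] , (here , [] ∷ []) , id
prefix {vs = u ∷ _} (step _ _ , _)      (here refl) = u ∷ [] , (here , [] ∷ []) , λ { (here refl) → here refl }
prefix              (step e p , u∉ ∷ uq) (there w∈)  with prefix (p , uq) w∈
... | ws , (q , uq′) , ws⊆ = _ ∷ ws , (step e q , anti-mono ws⊆ u∉ ∷ uq′) ,
  λ { (here refl) → here refl ; (there x∈) → there (ws⊆ x∈) }

module Tree {n : ℕ} {G : Graph n} (T : IsTree G) where
  open IsTree T renaming (symmetric to G-sym; irreflexive to G-irr)

  edge⇒≢ : ∀ {a b} → G a b → a ≢ b
  edge⇒≢ {a} e refl = G-irr a e

  no-triangle : ∀ {a b c} → G a b → G b c → ¬ G c a
  no-triangle {a} {b} {c} e f g = acyclic a c (a ∷ b ∷ c ∷ [])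
    ( step e (step f here)
    , ((edge⇒≢ e ∷ (edge⇒≢ g ∘ sym) ∷ []) ∷ (edge⇒≢ f ∷ []) ∷ [] ∷ []) )
    (s≤s (s≤s (s≤s z≤n))) g

  no-square : ∀ {a b c d} → a ≢ c → b ≢ d → G a b → G b c → G c d → ¬ G d a
  no-square {a} {b} {c} {d} a≢c b≢d e f g h = acyclic a d (a ∷ b ∷ c ∷ d ∷ [])
    ( step e (step f (step g here))
    , ((edge⇒≢ e ∷ a≢c ∷ (edge⇒≢ h ∘ sym) ∷ []) ∷ (edge⇒≢ f ∷ b≢d ∷ []) ∷ (edge⇒≢ g ∷ []) ∷ [] ∷ []) )
    (s≤s (s≤s (s≤s z≤n))) h

  -- If `w` occurred in `vs`, the part of the path from `x` to `w` would close to a cycle with the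
  -- edge `w x`. It has at least three vertices because `w ≢ p`.
  extend-path : ∀ {w x p y vs} → IsPath G x y (x ∷ p ∷ vs) → G w x → w ≢ p →
    IsPath G w y (w ∷ x ∷ p ∷ vs)
  extend-path {w} {x} {p} {y} {vs} (step e q , x∉ ∷ uq@(_ ∷ _)) g w≢p with walk-head q
  ... | refl = step g (step e q) , (edge⇒≢ g ∷ w≢p ∷ ¬Any⇒All¬ vs w∉vs) ∷ x∉ ∷ uq
    where
    two≤ : ∀ {ws} → Walk G p w ws → 2 ≤ℕ length ws
    two≤ here       = contradiction refl w≢p
    two≤ (step _ r) = s≤s (walk-length r)
    w∉vs : w ∉ vs
    w∉vs w∈ with prefix (q , uq) (there w∈)
    ... | ws , (r , uq′) , ws⊆ =
      acyclic x w (x ∷ ws) (step e r , anti-mono ws⊆ x∉ ∷ uq′) (s≤s (two≤ r)) g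

  -- `P k p` is a state attached to a step from `p` to `k`. If every state allowed a further step
  -- without backtracking, `extend-path` would build arbitrarily long paths; `long n` already has n
  -- + 2 vertices.
  no-ray : (P : Fin n → Fin n → Set) →
    (∀ k p → G k p → P k p → ∃[ k′ ] (k′ ≢ p × G k′ k × P k′ k)) →
    ∀ k p → G k p → ¬ P k p
  no-ray P next k p e Pkp with long n
    where
    long : ∀ m → ∃[ k ] ∃[ p ] ∃[ y ] ∃[ vs ]
      (IsPath G k y (k ∷ p ∷ vs) × G k p × P k p × length vs ≡ m)
    long zero = k , p , p , [] , (step e here , (edge⇒≢ e ∷ []) ∷ [] ∷ []) , e , Pkp , refl
    long (suc m) with long m
    ... | k , p , y , vs , path , e , Pkp , len with next k p e Pkp
    ... | k′ , k′≢p , e′ , Pk′k =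
      k′ , k , y , p ∷ vs , extend-path path e′ k′≢p , e′ , Pk′k , cong suc len
  ... | _ , _ , _ , vs , (_ , uq) , _ , _ , len =
    ℕₚ.<⇒≱ (ℕₚ.≤-trans (ℕₚ.n≤1+n _) (unique-length≤ uq)) (ℕₚ.≤-reflexive (sym len))

  walk-star : ∀ {c} → (∀ k j → G c k → G k j → j ≡ c) →
    ∀ {u v vs} → Walk G u v vs → u ≡ c ⊎ G c u → v ≡ c ⊎ G c v
  walk-star near here       h           = h
  walk-star near (step e p) (inj₁ refl) = walk-star near p (inj₂ e)
  walk-star near (step e p) (inj₂ cu)   = walk-star near p (inj₁ (near _ _ cu e))

  -- The hypothesis makes all neighbours of `c` leaves, so a walk from `c` never gets further than
  -- distance one; by connectedness this reaches every vertex.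
  near⇒star : ∀ c → (∀ k j → G c k → G k j → j ≡ c) → IsStar G
  near⇒star c near = c , λ i j e → helper i j e (walk-star near (proj₂ (connected c i)) (inj₁ refl))
    where
    helper : ∀ i j → G i j → i ≡ c ⊎ G c i → i ≡ c ⊎ j ≡ c
    helper i j e (inj₁ i≡c) = inj₁ i≡c
    helper i j e (inj₂ ci)  = inj₂ (near i j ci e)

-- Matchings

InM-sym : ∀ {n} {M : List (Fin n × Fin n)} {a b} → InM M a b → InM M b a
InM-sym = swap

InM⇒∈ : ∀ {n} {M : List (Fin n × Fin n)} {a b} → InM M a b → a ∈ endpoints M
InM⇒∈ (inj₁ (here refl)) = here refl
InM⇒∈ (inj₂ (here refl)) = there (here refl)
InM⇒∈ (inj₁ (there m))   = there (there (InM⇒∈ (inj₁ m)))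
InM⇒∈ (inj₂ (there m))   = there (there (InM⇒∈ (inj₂ m)))

InM-∷⁺ : ∀ {n} {M : List (Fin n × Fin n)} {e a b} → InM M a b → InM (e ∷ M) a b
InM-∷⁺ (inj₁ m) = inj₁ (there m)
InM-∷⁺ (inj₂ m) = inj₂ (there m)

covered⇒partner : ∀ {n} {M : List (Fin n × Fin n)} {a} → a ∈ endpoints M → ∃[ b ] InM M a b
covered⇒partner {M = (a , b) ∷ M} (here refl)         = b , inj₁ (here refl)
covered⇒partner {M = (a , b) ∷ M} (there (here refl)) = a , inj₂ (here refl)
covered⇒partner {M = e ∷ M}       (there (there a∈)) with covered⇒partner {M = M} a∈
... | b , m = b , InM-∷⁺ m

InM-∷⁻ : ∀ {n} {M : List (Fin n × Fin n)} {a b x y} → InM ((a , b) ∷ M) x y →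
  (x ≡ a × y ≡ b) ⊎ (x ≡ b × y ≡ a) ⊎ InM M x y
InM-∷⁻ (inj₁ (here refl)) = inj₁ (refl , refl)
InM-∷⁻ (inj₂ (here refl)) = inj₂ (inj₁ (refl , refl))
InM-∷⁻ (inj₁ (there m))   = inj₂ (inj₂ (inj₁ m))
InM-∷⁻ (inj₂ (there m))   = inj₂ (inj₂ (inj₂ m))

partner-unique : ∀ {n} {M : List (Fin n × Fin n)} {x y z} → Unique (endpoints M) →
  InM M x y → InM M x z → y ≡ z
partner-unique {M = []} _ (inj₁ ()) _
partner-unique {M = []} _ (inj₂ ()) _
partner-unique {M = (a , b) ∷ M} ((a≢b ∷ a∉) ∷ b∉ ∷ uq) m m′ with InM-∷⁻ m | InM-∷⁻ m′
... | inj₁ (refl , refl)        | inj₁ (refl , refl)        = refl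
... | inj₁ (refl , refl)        | inj₂ (inj₁ (refl , refl)) = contradiction refl a≢b
... | inj₁ (refl , refl)        | inj₂ (inj₂ m₂)            = ⊥-elim (All¬⇒¬Any a∉ (InM⇒∈ m₂))
... | inj₂ (inj₁ (refl , refl)) | inj₁ (refl , refl)        = contradiction refl a≢b
... | inj₂ (inj₁ (refl , refl)) | inj₂ (inj₁ (refl , refl)) = refl
... | inj₂ (inj₁ (refl , refl)) | inj₂ (inj₂ m₂)            = ⊥-elim (All¬⇒¬Any b∉ (InM⇒∈ m₂))
... | inj₂ (inj₂ m₁)            | inj₁ (refl , refl)        = ⊥-elim (All¬⇒¬Any a∉ (InM⇒∈ m₁))
... | inj₂ (inj₂ m₁)            | inj₂ (inj₁ (refl , refl)) = ⊥-elim (All¬⇒¬Any b∉ (InM⇒∈ m₁))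
... | inj₂ (inj₂ m₁)            | inj₂ (inj₂ m₂)            = partner-unique uq m₁ m₂

touches? : ∀ {n} (v : Fin n) (e : Fin n × Fin n) → Dec (proj₁ e ≡ v ⊎ proj₂ e ≡ v)
touches? v (a , b) = (a ≟ v) ⊎-dec (b ≟ v)

-- Mapped over a matching, this trades the edge at `v` for `(u , v)`. Doing it by `map` keeps the
-- length, and with it maximality.
replace : ∀ {n} → Fin n → Fin n → Fin n × Fin n → Fin n × Fin n
replace u v e with touches? v e
... | yes _ = u , v
... | no  _ = e

module _ {n : ℕ} (u v : Fin n) where

  replace-touching : ∀ e → proj₁ e ≡ v ⊎ proj₂ e ≡ v → replace u v e ≡ (u , v)
  replace-touching e t with touches? v e
  ... | yes _ = refl
  ... | no ¬t = contradiction t ¬t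

  replace-other : ∀ e → ¬ (proj₁ e ≡ v ⊎ proj₂ e ≡ v) → replace u v e ≡ e
  replace-other e ¬t with touches? v e
  ... | yes t = contradiction t ¬t
  ... | no _  = refl

  map-replace-id : ∀ M → v ∉ endpoints M → map (replace u v) M ≡ M
  map-replace-id []      _  = refl
  map-replace-id (e ∷ M) v∉ = cong₂ _∷_
    (replace-other e λ { (inj₁ refl) → v∉ (here refl) ; (inj₂ refl) → v∉ (there (here refl)) })
    (map-replace-id M (v∉ ∘ there ∘ there))

  ∈-endpoints-replace : ∀ M {x} → x ∈ endpoints (map (replace u v) M) →
    x ≡ u ⊎ x ≡ v ⊎ x ∈ endpoints M
  ∈-endpoints-replace (e ∷ M) x∈ with touches? v e
  ∈-endpoints-replace (e ∷ M) (here refl)         | yes _ = inj₁ refl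
  ∈-endpoints-replace (e ∷ M) (there (here refl)) | yes _ = inj₂ (inj₁ refl)
  ∈-endpoints-replace (e ∷ M) (here refl)         | no _  = inj₂ (inj₂ (here refl))
  ∈-endpoints-replace (e ∷ M) (there (here refl)) | no _  = inj₂ (inj₂ (there (here refl)))
  ∈-endpoints-replace (e ∷ M) (there (there x∈))  | _ with ∈-endpoints-replace M x∈
  ... | inj₁ x≡u         = inj₁ x≡u
  ... | inj₂ (inj₁ x≡v)  = inj₂ (inj₁ x≡v)
  ... | inj₂ (inj₂ x∈M)  = inj₂ (inj₂ (there (there x∈M)))

  unique-replace : ∀ M → u ≢ v → u ∉ endpoints M → Unique (endpoints M) →
    Unique (endpoints (map (replace u v) M))
  unique-replace []            _   _  _ = []
  unique-replace ((a , b) ∷ M) u≢v u∉ ((a≢b ∷ a∉) ∷ b∉ ∷ uq) with touches? v (a , b)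
  -- The edge at `v` has been found; no later edge touches `v`, so the rest of the list is
  -- unchanged.
  ... | yes (inj₁ refl) rewrite map-replace-id M (All¬⇒¬Any a∉) =
    (u≢v ∷ ¬Any⇒All¬ _ (u∉ ∘ there ∘ there)) ∷ a∉ ∷ uq
  ... | yes (inj₂ refl) rewrite map-replace-id M (All¬⇒¬Any b∉) =
    (u≢v ∷ ¬Any⇒All¬ _ (u∉ ∘ there ∘ there)) ∷ b∉ ∷ uq
  ... | no ¬t = (a≢b ∷ ¬Any⇒All¬ _ (fresh (u∉ ∘ here ∘ sym) (¬t ∘ inj₁) (All¬⇒¬Any a∉)))
    ∷ ¬Any⇒All¬ _ (fresh (u∉ ∘ there ∘ here ∘ sym) (¬t ∘ inj₂) (All¬⇒¬Any b∉))
    ∷ unique-replace M u≢v (u∉ ∘ there ∘ there) uq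
    where
    fresh : ∀ {x} → x ≢ u → x ≢ v → x ∉ endpoints M → x ∉ endpoints (map (replace u v) M)
    fresh x≢u x≢v x∉ x∈ with ∈-endpoints-replace M x∈
    ... | inj₁ x≡u        = x≢u x≡u
    ... | inj₂ (inj₁ x≡v) = x≢v x≡v
    ... | inj₂ (inj₂ x∈M) = x∉ x∈M

  ∈-replace⁺ : ∀ {M e e′} → replace u v e ≡ e′ → e ∈ M → e′ ∈ map (replace u v) M
  ∈-replace⁺ refl e∈ = ∈-map⁺ (replace u v) e∈

  InM-replace⁺ : ∀ {M x y} → InM M x y → x ≢ v → y ≢ v → InM (map (replace u v) M) x y
  InM-replace⁺ (inj₁ m) x≢v y≢v =
    inj₁ (∈-replace⁺ (replace-other _ λ { (inj₁ p) → x≢v p ; (inj₂ p) → y≢v p }) m)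
  InM-replace⁺ (inj₂ m) x≢v y≢v =
    inj₂ (∈-replace⁺ (replace-other _ λ { (inj₁ p) → y≢v p ; (inj₂ p) → x≢v p }) m)

  InM-replace-new : ∀ {M w} → InM M v w → InM (map (replace u v) M) u v
  InM-replace-new (inj₁ m) = inj₁ (∈-replace⁺ (replace-touching _ (inj₁ refl)) m)
  InM-replace-new (inj₂ m) = inj₁ (∈-replace⁺ (replace-touching _ (inj₂ refl)) m)

  ∈-replace⁻ : ∀ {M e} → e ∈ map (replace u v) M → e ∈ M ⊎ e ≡ (u , v)
  ∈-replace⁻ e∈ with ∈-map⁻ (replace u v) e∈
  ... | e′ , e′∈ , refl with touches? v e′
  ...   | yes _ = inj₂ refl
  ...   | no _  = inj₁ e′∈

  InM-replace⁻ : ∀ {M x y} → InM (map (replace u v) M) x y →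
    InM M x y ⊎ (x ≡ u × y ≡ v) ⊎ (x ≡ v × y ≡ u)
  InM-replace⁻ (inj₁ m) with ∈-replace⁻ m
  ... | inj₁ m′   = inj₁ (inj₁ m′)
  ... | inj₂ refl = inj₂ (inj₁ (refl , refl))
  InM-replace⁻ (inj₂ m) with ∈-replace⁻ m
  ... | inj₁ m′   = inj₁ (inj₂ m′)
  ... | inj₂ refl = inj₂ (inj₂ (refl , refl))

  replace-edges : ∀ {G : Graph n} → G u v → ∀ M → All (λ e → G (proj₁ e) (proj₂ e)) M →
    All (λ e → G (proj₁ e) (proj₂ e)) (map (replace u v) M)
  replace-edges g []      []       = []
  replace-edges g (e ∷ M) (h ∷ hs) with touches? v e
  ... | yes _ = g ∷ replace-edges g M hs
  ... | no _  = h ∷ replace-edges g M hs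

-- Alternating paths

-- Adjacency in the graph of alternating paths. Both orientations are stored, since
-- `AlternatingPathBetween` is directed while the count uses only the pair with the smaller index
-- first.
record Linked {n : ℕ} (G : Graph n) (a b : Fin n) : Set₁ where
  constructor linked
  field
    distinct : a ≢ b
    forth    : AlternatingPathBetween G a b
    back     : AlternatingPathBetween G b a

Linked-sym : ∀ {n} {G : Graph n} {a b} → Linked G a b → Linked G b a
Linked-sym (linked a≢b p q) = linked (a≢b ∘ sym) q p

module Matching {n : ℕ} {G : Graph n} (T : IsTree G) where
  open IsTree T renaming (symmetric to G-sym; irreflexive to G-irr)
  open Tree T
  open import Data.List.Membership.DecPropositional (_≟_ {n}) using (_∈?_)

  InM⇒edge : ∀ {M a b} → IsMatching G M → InM M a b → G a b
  InM⇒edge (es , _) (inj₁ m) = All.lookup es m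
  InM⇒edge (es , _) (inj₂ m) = G-sym _ _ (All.lookup es m)

  neighbour-covered : ∀ {M a b} → IsMaximumMatching G M → a ∉ endpoints M → G a b →
    b ∈ endpoints M
  neighbour-covered {M} {a} {b} ((es , uq) , mx) a∉ e with b ∈? endpoints M
  ... | yes b∈ = b∈
  ... | no b∉  = contradiction
    (mx ((a , b) ∷ M) (e ∷ es , (edge⇒≢ e ∷ ¬Any⇒All¬ _ a∉) ∷ ¬Any⇒All¬ _ b∉ ∷ uq))
    ℕₚ.1+n≰n

  record Exchange (M : List (Fin n × Fin n)) (u v w : Fin n) : Set where
    field
      M′      : List (Fin n × Fin n)
      maximum : IsMaximumMatching G M′
      new     : InM M′ u v
      exposed : w ∉ endpoints M′
      kept    : ∀ {x y} → InM M x y → x ≢ v → y ≢ v → InM M′ x y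
      old     : ∀ {x y} → InM M′ x y → InM M x y ⊎ (x ≡ u × y ≡ v) ⊎ (x ≡ v × y ≡ u)

  -- The vertex `w` becomes exposed: an edge at `w` in the new matching would come from `M`, hence
  -- be `wv`, but the new partner of `v` is `u`.
  exchange : ∀ {M u v w} → IsMaximumMatching G M → u ∉ endpoints M → G u v → InM M v w →
    Exchange M u v w
  exchange {M} {u} {v} {w} ((es , uq) , mx) u∉ e vw = record
    { M′      = M′
    ; maximum = (replace-edges u v {G} e M es , uq′)
              , λ N N-matching → subst (length N ≤ℕ_) (sym (length-map _ M)) (mx N N-matching)
    ; new     = new
    ; exposed = w∉
    ; kept    = InM-replace⁺ u v
    ; old     = InM-replace⁻ u v
    }
    where
    M′ = map (replace u v) M
    uq′ = unique-replace u v M (edge⇒≢ e) u∉ uq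
    new : InM M′ u v
    new = InM-replace-new u v vw
    w≢u : w ≢ u
    w≢u refl = u∉ (InM⇒∈ (InM-sym {M = M} vw))
    w∉ : w ∉ endpoints M′
    w∉ w∈ with covered⇒partner {M = M′} w∈
    ... | y , wy with InM-replace⁻ u v wy
    ...   | inj₂ (inj₁ (refl , _)) = w≢u refl
    ...   | inj₂ (inj₂ (refl , _)) = G-irr _ (InM⇒edge (es , uq) vw)
    ...   | inj₁ wy′ with partner-unique uq (InM-sym {M = M} vw) wy′
    ...     | refl = w≢u (partner-unique uq′ (InM-sym {M = M′} wy) (InM-sym {M = M′} new))

  matched-linked : ∀ {M a b} → IsMaximumMatching G M → InM M a b → Linked G a b
  matched-linked {M} {a} {b} mx@(mt , _) ab = linked (edge⇒≢ e)
    (M , a ∷ b ∷ [] , mx , (step e here , (edge⇒≢ e ∷ []) ∷ [] ∷ []) , ab)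
    (M , b ∷ a ∷ [] , mx
      , (step (G-sym _ _ e) here , ((edge⇒≢ e ∘ sym) ∷ []) ∷ [] ∷ []) , InM-sym {M = M} ab)
    where
    e : G a b
    e = InM⇒edge mt ab

  -- Uniqueness of partners supplies what is left to check: `bc` lies outside `M`, and `a`, `b` both
  -- differ from `d`.
  path-alternating : ∀ {M a b c d} → IsMaximumMatching G M →
    InM M a b → G b c → InM M c d → a ≢ c → a ≢ d × AlternatingPathBetween G a d
  path-alternating {M} {a} {b} {c} {d} mx@(mt@(_ , uq) , _) ab bc cd a≢c =
    a≢d , M , a ∷ b ∷ c ∷ d ∷ [] , mx
    , ( step (InM⇒edge mt ab) (step bc (step (InM⇒edge mt cd) here))
      , (edge⇒≢ (InM⇒edge mt ab) ∷ a≢c ∷ a≢d ∷ []) ∷ (edge⇒≢ bc ∷ b≢d ∷ [])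
        ∷ (edge⇒≢ (InM⇒edge mt cd) ∷ []) ∷ [] ∷ [] )
    , ab , (λ bc′ → a≢c (partner-unique uq (InM-sym {M = M} ab) bc′)) , cd
    where
    a≢d : a ≢ d
    a≢d refl = edge⇒≢ bc (partner-unique uq ab (InM-sym {M = M} cd))
    b≢d : b ≢ d
    b≢d refl = a≢c (partner-unique uq (InM-sym {M = M} ab) (InM-sym {M = M} cd))

  path-linked : ∀ {M a b c d} → IsMaximumMatching G M →
    InM M a b → G b c → InM M c d → a ≢ c → Linked G a d
  path-linked {M} {a} {b} {c} {d} mx@((_ , uq) , _) ab bc cd a≢c =
    linked (proj₁ there-path) (proj₂ there-path)
      (proj₂ (path-alternating mx (InM-sym {M = M} cd) (G-sym _ _ bc) (InM-sym {M = M} ab) d≢b))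
    where
    there-path = path-alternating mx ab bc cd a≢c
    d≢b : d ≢ b
    d≢b refl = a≢c (partner-unique uq (InM-sym {M = M} ab) (InM-sym {M = M} cd))

  record LinkedSquare : Set₁ where
    constructor square
    field
      {a b c d} : Fin n
      a≢c       : a ≢ c
      b≢d       : b ≢ d
      ab        : Linked G a b
      bc        : Linked G b c
      cd        : Linked G c d
      da        : Linked G d a

  -- A neighbour `z ≢ v` of `w`, with partner `z′`, would make `v`, `w`, `z`, `z′` a square of
  -- links: `vw` and `zz′` are matching edges, `wz` becomes one after two exchanges, and the path
  -- `v w z z′` alternates in `M`.
  partner-leaf : ¬ LinkedSquare → ∀ {M u v w} → IsMaximumMatching G M → u ∉ endpoints M →
    G u v → InM M v w → ∀ z → G w z → z ≡ v
  partner-leaf no-sq {M} {u} {v} {w} mx@(mt , _) u∉ uv vw z wz with z ≟ v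
  ... | yes z≡v = z≡v
  ... | no z≢v  = ⊥-elim (no-sq (square (z≢v ∘ sym) w≢z′
      (matched-linked mx vw)
      (matched-linked X₂.maximum X₂.new)
      (matched-linked X.maximum zz′)
      (Linked-sym (path-linked mx vw wz zz′-old (z≢v ∘ sym)))))
    where
    module X = Exchange (exchange mx u∉ uv vw)
    z-partner = covered⇒partner {M = X.M′} (neighbour-covered X.maximum X.exposed wz)
    z′ = proj₁ z-partner
    zz′ : InM X.M′ z z′
    zz′ = proj₂ z-partner
    -- The first exchange exposed `w`, so a second one can trade `zz′` for `wz`.
    module X₂ = Exchange (exchange X.maximum X.exposed wz zz′)
    w≢z′ : w ≢ z′
    w≢z′ w≡z′ = X.exposed (subst (_∈ _) (sym w≡z′) (InM⇒∈ (InM-sym {M = X.M′} zz′)))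
    zz′-old : InM M z z′
    zz′-old with X.old zz′
    ... | inj₁ m                = m
    ... | inj₂ (inj₁ (z≡u , _)) = ⊥-elim (no-triangle uv (InM⇒edge mt vw) (subst (G w) z≡u wz))
    ... | inj₂ (inj₂ (z≡v , _)) = contradiction z≡v z≢v

  -- The exchange at `v` swaps the roles of `u` and `w`, which turns `partner-leaf` into a statement
  -- about `u`.
  exposed-leaf : ¬ LinkedSquare → ∀ {M u v w} → IsMaximumMatching G M → u ∉ endpoints M →
    G u v → InM M v w → ∀ z → G u z → z ≡ v
  exposed-leaf no-sq {M} {u} {v} {w} mx@(mt , _) u∉ uv vw =
    partner-leaf no-sq X.maximum X.exposed (G-sym _ _ (InM⇒edge mt vw)) (InM-sym {M = X.M′} X.new)
    where
    module X = Exchange (exchange mx u∉ uv vw)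

  -- If `x` had a partner `y`, then `u`, `v`, `w`, `y` would be a square of links: `uv` and `vw` lie
  -- in maximum matchings, `w v x y` alternates in `M`, and `u v x y` alternates after the exchange.
  other-exposed : ¬ LinkedSquare → ∀ {M u v w x} → IsMaximumMatching G M → u ∉ endpoints M →
    G u v → InM M v w → G v x → x ≢ w → x ∉ endpoints M
  other-exposed no-sq {M} {u} {v} {w} {x} mx@(mt , _) u∉ uv vw vx x≢w x∈
    with covered⇒partner {M = M} x∈
  ... | y , xy = no-sq (square (u≢ vw) v≢y
      (matched-linked X.maximum X.new)
      (matched-linked mx vw)
      (path-linked mx (InM-sym {M = M} vw) vx xy (x≢w ∘ sym))
      (Linked-sym (path-linked X.maximum X.new vx (X.kept xy (edge⇒≢ vx ∘ sym) (v≢y ∘ sym)) u≢x)))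
    where
    module X = Exchange (exchange mx u∉ uv vw)
    u≢ : ∀ {a b} → InM M a b → u ≢ b
    u≢ m refl = u∉ (InM⇒∈ (InM-sym {M = M} m))
    v≢y : v ≢ y
    v≢y refl = x≢w (partner-unique (proj₂ mt) (InM-sym {M = M} xy) vw)
    u≢x : u ≢ x
    u≢x refl = u∉ x∈

  -- Each neighbour of `v` is either its partner `w` or exposed by `other-exposed`, and both kinds
  -- are leaves.
  squareless⇒star : ¬ LinkedSquare → ∀ {M u v} → IsMaximumMatching G M → u ∉ endpoints M →
    G u v → IsStar G
  squareless⇒star no-sq {M} {u} {v} mx u∉ uv
    with covered⇒partner {M = M} (neighbour-covered mx u∉ uv)
  ... | w , vw = near⇒star v near
    where
    near : ∀ k j → G v k → G k j → j ≡ v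
    near k j vk kj with k ≟ w
    ... | yes refl = partner-leaf no-sq mx u∉ uv vw j kj
    ... | no k≢w   = exposed-leaf no-sq mx (other-exposed no-sq mx u∉ uv vw vk k≢w)
                       (G-sym _ _ vk) vw j kj

  -- A labelling constant on the components of the graph of links. Connectedness of that graph is
  -- expressed by all such labellings being constant, the form in which edges are counted later.
  Invariant : (Fin n → Fin n) → Set₁
  Invariant f = ∀ {a b} → Linked G a b → f a ≡ f b

  -- If an end of `xy` is exposed, an exchange puts `xy` into a maximum matching. If both ends are
  -- covered and `xy` is not in `M`, the links `x x′`, `x′ y′`, `y′ y` connect them, the middle one
  -- by the path `x′ x y y′`.
  invariant-edge : ∀ {M} → IsMaximumMatching G M → ∀ f → Invariant f → ∀ {x y} → G x y → f x ≡ f y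
  invariant-edge {M} mx f inv {x} {y} xy with x ∈? endpoints M | y ∈? endpoints M
  ... | no x∉  | _ = inv (matched-linked X.maximum X.new)
    where
    module X = Exchange (exchange mx x∉ xy (proj₂ (covered⇒partner {M = M} (neighbour-covered mx x∉ xy))))
  ... | yes x∈ | no y∉ = sym (inv (matched-linked X.maximum X.new))
    where
    module X = Exchange (exchange mx y∉ (G-sym _ _ xy) (proj₂ (covered⇒partner {M = M} x∈)))
  ... | yes x∈ | yes y∈ with covered⇒partner {M = M} x∈ | covered⇒partner {M = M} y∈
  ...   | x′ , xx′ | y′ , yy′ with x′ ≟ y
  ...     | yes refl = inv (matched-linked mx xx′)
  ...     | no x′≢y  = trans (inv (matched-linked mx xx′))
    (trans (inv (path-linked mx (InM-sym {M = M} xx′) xy yy′ x′≢y)) (sym (inv (matched-linked mx yy′))))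

  invariant-constant : ∀ {M} → IsMaximumMatching G M → ∀ f → Invariant f → ∀ x y → f x ≡ f y
  invariant-constant mx f inv x y = along (proj₂ (connected x y))
    where
    along : ∀ {x y vs} → Walk G x y vs → f x ≡ f y
    along here       = refl
    along (step e p) = trans (invariant-edge mx f inv e) (along p)

-- The number of edges needed for connectedness.

length-remove : ∀ {n} (c : Fin n) {L} → Unique L →
  length L ≤ℕ suc (length (filter (λ l → ¬? (l ≟ c)) L))
length-remove c []                 = z≤n
length-remove c {l ∷ L} (l∉ ∷ uq) with l ≟ c
... | yes refl rewrite filter-all (λ l → ¬? (l ≟ c)) (All.map (_∘ sym) l∉) = ℕₚ.≤-refl
... | no l≢c   = s≤s (length-remove c uq)

Respects : ∀ {n} → List (Fin n × Fin n) → (Fin n → Fin n) → Set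
Respects es f = ∀ {x y} → (x , y) ∈ es → f x ≡ f y

-- f labels the vertices by their components, of which k edges leave at least n ∸ k.
components : ∀ {n} (es : List (Fin n × Fin n)) →
  Σ (Fin n → Fin n) λ f → Σ (List (Fin n)) λ L → Respects es f
    × Unique L × (∀ {l} → l ∈ L → ∃[ x ] f x ≡ l) × n ≤ℕ length L +ℕ length es
components {n} [] = id , allFin n , (λ ()) , allFin⁺ n , (λ {l} _ → l , refl) ,
  ℕₚ.≤-reflexive (sym (trans (ℕₚ.+-identityʳ _) (length-tabulate id)))
components {n} ((a , b) ∷ es) with components es
... | f , L , resp , uq , img , bound = g , L′ , resp′ , filter⁺ _ uq , img′ , bound′
  where
  g : Fin n → Fin n
  g x with f x ≟ f a
  ... | yes _ = f b
  ... | no _  = f x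
  g-cong : ∀ {x y} → f x ≡ f y → g x ≡ g y
  g-cong {x} {y} eq with f x ≟ f a | f y ≟ f a
  ... | yes _ | yes _ = refl
  ... | yes p | no ¬q = contradiction (trans (sym eq) p) ¬q
  ... | no ¬p | yes q = contradiction (trans eq q) ¬p
  ... | no _  | no _  = eq
  g-ab : g a ≡ g b
  g-ab with f a ≟ f a | f b ≟ f a
  ... | yes _ | yes _ = refl
  ... | yes _ | no _  = refl
  ... | no ¬p | _     = contradiction refl ¬p
  g-other : ∀ {x} → f x ≢ f a → g x ≡ f x
  g-other {x} ne with f x ≟ f a
  ... | yes p = contradiction p ne
  ... | no _  = refl
  L′ = filter (λ l → ¬? (l ≟ f a)) L
  resp′ : Respects ((a , b) ∷ es) g
  resp′ (here refl) = g-ab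
  resp′ (there e∈)  = g-cong (resp e∈)
  img′ : ∀ {l} → l ∈ L′ → ∃[ x ] g x ≡ l
  img′ l∈ with ∈-filter⁻ (λ l → ¬? (l ≟ f a)) {xs = L} l∈
  ... | l∈L , l≢ with img l∈L
  ...   | x , refl = x , g-other l≢
  bound′ : n ≤ℕ length L′ +ℕ suc (length es)
  bound′ = ℕₚ.≤-trans bound (ℕₚ.≤-trans (ℕₚ.+-monoˡ-≤ (length es) (length-remove (f a) uq))
    (ℕₚ.≤-reflexive (sym (ℕₚ.+-suc _ _))))

-- The component labelling from `components` respects `es`, so it is constant and its list of labels
-- has at most one entry.
connected⇒edges : ∀ {n} (es : List (Fin n × Fin n)) →
  (∀ f → Respects es f → ∀ x y → f x ≡ f y) → n ≤ℕ suc (length es)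
connected⇒edges es const with components es
... | f , L , resp , uq , img , bound = ℕₚ.≤-trans bound (ℕₚ.+-monoˡ-≤ (length es) (short uq img))
  where
  short : ∀ {L} → Unique L → (∀ {l} → l ∈ L → ∃[ x ] f x ≡ l) → length L ≤ℕ 1
  short {[]}         _                   _   = z≤n
  short {_ ∷ []}     _                   _   = s≤s z≤n
  short {k ∷ l ∷ _}  ((k≢l ∷ _) ∷ _) img with img (here refl) | img (there (here refl))
  ... | x , refl | y , refl = contradiction (const f resp x y) k≢l

module _ {n : ℕ} {G : Graph n} (T : IsTree G) where
  open Matching T

  -- Every link is a listed pair, and the links connect all n vertices. One side of a square is
  -- redundant for this, so n - 2 pairs would already connect them, against `connected⇒edges`.
  too-few-paths⇒squareless : ∀ {M} → IsMaximumMatching G M → NumAlternatingPaths≡ G (n ∸ 1) →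
    ¬ LinkedSquare
  too-few-paths⇒squareless mx (ps , _ , len , paths) (square {a} {b} {c} {d} a≢c b≢d ab bc cd da) =
    refute (link⇒InM ab)
    where
    link⇒InM : ∀ {x y} → Linked G x y → InM ps x y
    link⇒InM {x} {y} (linked x≢y p q) with ℕₚ.<-cmp (toℕ x) (toℕ y)
    ... | tri< x<y _ _ = inj₁ (Equivalence.from (paths x y) (x<y , p))
    ... | tri≈ _ eq _  = contradiction (toℕ-injective eq) x≢y
    ... | tri> _ _ y<x = inj₂ (Equivalence.from (paths y x) (y<x , q))

    -- Dropping the edge e of the square leaves the links connected.
    shorten : ∀ e → e ∈ ps → e ≡ (a , b) ⊎ e ≡ (b , a) → ⊥
    shorten e e∈ e-ab with ∈-∃++ e∈
    ... | xs , ys , refl = ℕₚ.1+n≰n (begin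
        suc (n ∸ 1)                      ≡⟨ ℕₚ.m+[n∸m]≡n (IsTree.nonempty T) ⟩
        n                                ≤⟨ connected⇒edges (xs ++ ys) const ⟩
        suc (length (xs ++ ys))          ≡⟨ sym (length-++-sucʳ xs e ys) ⟩
        length (xs ++ e ∷ ys)            ≡⟨ len ⟩
        n ∸ 1                            ∎)
      where
      open ℕₚ.≤-Reasoning
      const : ∀ f → Respects (xs ++ ys) f → ∀ x y → f x ≡ f y
      const f resp = invariant-constant mx f inv
        where
        ∈-rest : ∀ {x y} → (x , y) ∈ xs ++ e ∷ ys → (x , y) ≡ e ⊎ f x ≡ f y
        ∈-rest m with ∈-++⁻ xs m
        ... | inj₁ m′          = inj₂ (resp (∈-++⁺ˡ m′))
        ... | inj₂ (here p)    = inj₁ p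
        ... | inj₂ (there m′)  = inj₂ (resp (∈-++⁺ʳ xs m′))
        SameAB : Fin n → Fin n → Set
        SameAB x y = (x ≡ a × y ≡ b) ⊎ (x ≡ b × y ≡ a)
        same : ∀ {x y} → (x , y) ≡ e → e ≡ (a , b) ⊎ e ≡ (b , a) → SameAB x y
        same refl (inj₁ refl) = inj₁ (refl , refl)
        same refl (inj₂ refl) = inj₂ (refl , refl)
        compare : ∀ {x y} → Linked G x y → SameAB x y ⊎ f x ≡ f y
        compare l with link⇒InM l
        compare l | inj₁ m with ∈-rest m
        ... | inj₁ xy≡e = inj₁ (same xy≡e e-ab)
        ... | inj₂ eq   = inj₂ eq
        compare l | inj₂ m with ∈-rest m
        ... | inj₁ yx≡e = inj₁ (swap (Sum.map ×.swap ×.swap (same yx≡e e-ab)))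
        ... | inj₂ eq   = inj₂ (sym eq)
        other : ∀ {x y} → Linked G x y → ¬ SameAB x y → f x ≡ f y
        other l ne with compare l
        ... | inj₁ s  = contradiction s ne
        ... | inj₂ eq = eq
        -- The detour along the other three sides replaces `ab`; `a ≢ c` and `b ≢ d` help to show
        -- that none of them is `ab` itself.
        f-ab : f a ≡ f b
        f-ab = sym (trans
          (other bc λ { (inj₁ (refl , refl)) → Linked.distinct ab refl ; (inj₂ (_ , c≡a)) → a≢c (sym c≡a) })
          (trans
            (other cd λ { (inj₁ (c≡a , _)) → a≢c (sym c≡a) ; (inj₂ (_ , refl)) → Linked.distinct da refl })
            (other da λ { (inj₁ (refl , _)) → Linked.distinct da refl ; (inj₂ (d≡b , _)) → b≢d (sym d≡b) })))
        inv : Invariant f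
        inv l with compare l
        ... | inj₁ (inj₁ (refl , refl)) = f-ab
        ... | inj₁ (inj₂ (refl , refl)) = sym f-ab
        ... | inj₂ eq                   = eq

    refute : InM ps a b → ⊥
    refute (inj₁ m) = shorten _ m (inj₁ refl)
    refute (inj₂ m) = shorten _ m (inj₂ refl)

-- Alternating paths in a star.

walk-start : ∀ {n} {G : Graph n} {u v vs} → Walk G u v vs → u ∈ vs
walk-start here       = here refl
walk-start (step _ _) = here refl

-- The form in which `NumAlternatingPaths≡` lists the pair of two distinct vertices.
ordered : ∀ {n} → Fin n → Fin n → Fin n × Fin n
ordered a b with toℕ a ℕₚ.<? toℕ b
... | yes _ = a , b
... | no _  = b , a

ordered-< : ∀ {n} {a b : Fin n} → toℕ a <ℕ toℕ b → ordered a b ≡ (a , b)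
ordered-< {a = a} {b} a<b with toℕ a ℕₚ.<? toℕ b
... | yes _   = refl
... | no ¬a<b = contradiction a<b ¬a<b

ordered-> : ∀ {n} {a b : Fin n} → toℕ b <ℕ toℕ a → ordered a b ≡ (b , a)
ordered-> {a = a} {b} b<a with toℕ a ℕₚ.<? toℕ b
... | yes a<b = contradiction a<b (ℕₚ.<-asym b<a)
... | no _    = refl

ordered-injective : ∀ {n} {c x y : Fin n} → x ≢ c → y ≢ c → ordered c x ≡ ordered c y → x ≡ y
ordered-injective {c = c} {x} {y} x≢c y≢c eq with toℕ c ℕₚ.<? toℕ x | toℕ c ℕₚ.<? toℕ y
... | yes _ | yes _ = cong proj₂ eq
... | yes _ | no _  = contradiction (cong proj₂ eq) x≢c
... | no _  | yes _ = contradiction (sym (cong proj₂ eq)) y≢c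
... | no _  | no _  = cong proj₁ eq

module _ {m : ℕ} {G : Graph (suc m)} (T : IsTree G) (star : IsStar G) where
  open IsTree T renaming (symmetric to G-sym; irreflexive to G-irr)
  open Tree T
  open Matching T

  private
    c = proj₁ star

  disjoint-edges : ∀ {x y z w} → G x y → G z w → x ≢ z → x ≢ w → y ≢ z → ¬ y ≢ w
  disjoint-edges xy zw x≢z x≢w y≢z y≢w with proj₂ star _ _ xy | proj₂ star _ _ zw
  ... | inj₁ refl | inj₁ refl = x≢z refl
  ... | inj₁ refl | inj₂ refl = x≢w refl
  ... | inj₂ refl | inj₁ refl = y≢z refl
  ... | inj₂ refl | inj₂ refl = y≢w refl

  star-edge : ∀ {x} → x ≢ c → G c x
  star-edge {x} x≢c with connected x c
  ... | _ , here = contradiction refl x≢c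
  ... | _ , step {w = w} e _ with proj₂ star _ _ e
  ...   | inj₁ x≡c  = contradiction x≡c x≢c
  ...   | inj₂ refl = G-sym _ _ e

  star-maximum : ∀ {x} → x ≢ c → IsMaximumMatching G ((c , x) ∷ [])
  star-maximum {x} x≢c = (star-edge x≢c ∷ [] , ((x≢c ∘ sym) ∷ []) ∷ [] ∷ []) , small
    where
    small : ∀ M → IsMatching G M → length M ≤ℕ 1
    small []          _ = z≤n
    small (_ ∷ [])    _ = s≤s z≤n
    small (_ ∷ _ ∷ _) (e ∷ f ∷ _ , (_ ∷ p ∷ q ∷ _) ∷ (r ∷ s ∷ _) ∷ _) =
      ⊥-elim (disjoint-edges e f p q r s)

  -- An alternating path with more than one edge has at least three. Its first and third edges are
  -- disjoint, but in a star both contain the centre.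
  star-alternating⇒edge : ∀ {u v} → AlternatingPathBetween G u v → G u v
  star-alternating⇒edge (_ , _ , _ , (here , _) , ())
  star-alternating⇒edge (_ , _ , _ , (step e here , _) , _) = e
  star-alternating⇒edge (_ , _ , _ , (step _ (step _ here) , _) , _ , _ , ())
  star-alternating⇒edge (_ , _ , _ , (step e (step f (step g p)) , (_ ∷ p₁ ∷ a∉) ∷ (q₁ ∷ b∉) ∷ _) , _) =
    ⊥-elim (disjoint-edges e g p₁ (All.lookup a∉ (walk-start p)) q₁ (All.lookup b∉ (walk-start p)))

  -- The alternating paths are the single edges at the centre, and `punchIn c` enumerates their `m`
  -- outer ends.
  star⇒paths : NumAlternatingPaths≡ G m
  star⇒paths = ps , map⁺ spoke-injective (allFin⁺ m)
    , trans (length-map spoke (allFin m)) (length-tabulate id) , λ u v → mk⇔ to from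
    where
    leaf≢c : ∀ j → punchIn c j ≢ c
    leaf≢c j = punchInᵢ≢i c j
    spoke : Fin m → Fin (suc m) × Fin (suc m)
    spoke j = ordered c (punchIn c j)
    spoke-injective : ∀ {i j} → spoke i ≡ spoke j → i ≡ j
    spoke-injective {i} {j} eq =
      punchIn-injective c i j (ordered-injective (leaf≢c i) (leaf≢c j) eq)
    ps = map spoke (allFin m)
    ∈-ps : ∀ {x} → x ≢ c → ordered c x ∈ ps
    ∈-ps {x} x≢c = subst (λ y → ordered c y ∈ ps) (punchIn-punchOut (x≢c ∘ sym)) (∈-map⁺ spoke (∈-allFin _))
    link : ∀ {x} → x ≢ c → Linked G c x
    link x≢c = matched-linked (star-maximum x≢c) (inj₁ (here refl))
    to : ∀ {u v} → (u , v) ∈ ps → toℕ u <ℕ toℕ v × AlternatingPathBetween G u v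
    to uv∈ with ∈-map⁻ spoke uv∈
    ... | j , _ , eq with ℕₚ.<-cmp (toℕ c) (toℕ (punchIn c j))
    ...   | tri≈ _ c≡j _ = contradiction (sym (toℕ-injective c≡j)) (leaf≢c j)
    ...   | tri< c<j _ _ with trans eq (ordered-< c<j)
    ...     | refl = c<j , Linked.forth (link (leaf≢c j))
    to uv∈ | j , _ , eq | tri> _ _ j<c with trans eq (ordered-> j<c)
    ...     | refl = j<c , Linked.back (link (leaf≢c j))
    from : ∀ {u v} → toℕ u <ℕ toℕ v × AlternatingPathBetween G u v → (u , v) ∈ ps
    from (u<v , alt) with proj₂ star _ _ (star-alternating⇒edge alt)
    ... | inj₁ refl = subst (_∈ ps) (ordered-< u<v) (∈-ps λ { refl → ℕₚ.<-irrefl refl u<v })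
    ... | inj₂ refl = subst (_∈ ps) (ordered-> u<v) (∈-ps λ { refl → ℕₚ.<-irrefl refl u<v })

-- Graphs without squares.

record Squarefree {n : ℕ} (G : Graph n) : Set where
  field
    symmetric   : ∀ {i j} → G i j → G j i
    irreflexive : ∀ {i} → ¬ G i i
    no-square   : ∀ {a b c d} → a ≢ c → b ≢ d → G a b → G b c → G c d → ¬ G d a

tree⇒squarefree : ∀ {n} {G : Graph n} → IsTree G → Squarefree G
tree⇒squarefree T = record
  { symmetric   = IsTree.symmetric T _ _
  ; irreflexive = IsTree.irreflexive T _
  ; no-square   = Tree.no-square T
  }

-- With this, conditions (ii) and (iv) give the same information about T#, and one argument serves
-- both.
isomorphic-squarefree : ∀ {n} {G H : Graph n} → Isomorphic G H → Squarefree H → Squarefree G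
isomorphic-squarefree {G = G} {H} (σ , iso) S = record
  { symmetric   = λ e → from (S.symmetric (to e))
  ; irreflexive = λ e → S.irreflexive (to e)
  ; no-square   = λ a≢c b≢d e f g h → S.no-square (σ-≢ a≢c) (σ-≢ b≢d) (to e) (to f) (to g) (to h)
  }
  where
  module S = Squarefree S
  to : ∀ {i j} → G i j → H (Inverse.to σ i) (Inverse.to σ j)
  to = Equivalence.to (iso _ _)
  from : ∀ {i j} → H (Inverse.to σ i) (Inverse.to σ j) → G i j
  from = Equivalence.from (iso _ _)
  σ-≢ : ∀ {i j} → i ≢ j → Inverse.to σ i ≢ Inverse.to σ j
  σ-≢ i≢j eq = i≢j (trans (sym (Inverse.strictlyInverseʳ σ _))
    (trans (cong (Inverse.from σ) eq) (Inverse.strictlyInverseʳ σ _)))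

map-walk : ∀ {n} {G H : Graph n} → (∀ {i j} → G i j → H i j) → ∀ {u v vs} → Walk G u v vs → Walk H u v vs
map-walk φ here       = here
map-walk φ (step e p) = step (φ e) (map-walk φ p)

tree-resp-⇔ : ∀ {n} {G H : Graph n} → (∀ {i j} → G i j → H i j) → (∀ {i j} → H i j → G i j) →
  IsTree G → IsTree H
tree-resp-⇔ φ ψ T = record
  { nonempty    = nonempty
  ; symmetric   = λ i j e → φ (symmetric i j (ψ e))
  ; irreflexive = λ i e → irreflexive i (ψ e)
  ; connected   = λ u v → ×.map₂ (map-walk φ) (connected u v)
  ; acyclic     = λ u v vs (p , uq) 3≤ e → acyclic u v vs (map-walk ψ p , uq) 3≤ (ψ e)
  }
  where open IsTree T

-- Matrices over the reals

module _ (R : Reals) where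
  open Reals R
  open IsStrictTotalOrder isStrictTotalOrder
    using (compare) renaming (_≟_ to _≟ℝ_; irrefl to <-irrefl; trans to <-trans)

  private
    ring : CommutativeRing 0ℓ 0ℓ
    ring = record { isCommutativeRing = isCommutativeRing }

  open CommutativeRing ring
    using (+-identityˡ; +-identityʳ; -‿inverseʳ; *-assoc; *-comm; *-identityˡ; *-identityʳ;
           zeroˡ; zeroʳ; distribˡ)
  open import Algebra.Properties.Ring (CommutativeRing.ring ring)
    using (-‿distribˡ-*; -‿distribʳ-*; -‿involutive; x∙y⁻¹≈ε⇒x≈y; +-identityʳ-unique)
  open import Algebra.Properties.Semiring.Sum (CommutativeRing.semiring ring)
    using (sum; sum-cong-≗; sum-replicate-zero; sum-remove; ∑-comm; ∑-distrib-+;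
           *-distribˡ-sum; *-distribʳ-sum)

  ≢0-*⁻ : ∀ {x y} → x * y ≢ 0ℝ → x ≢ 0ℝ × y ≢ 0ℝ
  ≢0-*⁻ xy≢0 = (λ { refl → xy≢0 (zeroˡ _) }) , (λ { refl → xy≢0 (zeroʳ _) })

  ≢0-* : ∀ {x y} → x ≢ 0ℝ → y ≢ 0ℝ → x * y ≢ 0ℝ
  ≢0-* {x} {y} x≢0 y≢0 xy≡0 with inverse x x≢0
  ... | x⁻¹ , xx⁻¹≡1 = y≢0 (begin
    y              ≡⟨ sym (*-identityˡ y) ⟩
    1ℝ * y         ≡⟨ cong (_* y) (sym xx⁻¹≡1) ⟩
    x * x⁻¹ * y    ≡⟨ cong (_* y) (*-comm x x⁻¹) ⟩
    x⁻¹ * x * y    ≡⟨ *-assoc x⁻¹ x y ⟩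
    x⁻¹ * (x * y)  ≡⟨ cong (x⁻¹ *_) xy≡0 ⟩
    x⁻¹ * 0ℝ       ≡⟨ zeroʳ x⁻¹ ⟩
    0ℝ             ∎)
    where open ≡-Reasoning

  -- Trichotomy decides equality of reals. An edge of `graphOf` is a negated equation, so a non-edge
  -- becomes an equation again.
  stable : ∀ {x y : ℝ} → ¬ x ≢ y → x ≡ y
  stable {x} {y} = decidable-stable (x ≟ℝ y)

  0<x*x : ∀ {x} → x ≢ 0ℝ → 0ℝ < x * x
  0<x*x {x} x≢0 with compare 0ℝ x
  ... | tri< 0<x _ _ = *-pos 0<x 0<x
  ... | tri≈ _ 0≡x _ = contradiction (sym 0≡x) x≢0
  ... | tri> _ _ x<0 = subst (0ℝ <_) square-neg (*-pos 0<-x 0<-x)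
    where
    0<-x : 0ℝ < - x
    0<-x = subst (_< - x) (-‿inverseʳ x) (subst (x + - x <_) (+-identityˡ (- x)) (+-mono-< (- x) x<0))
    square-neg : - x * - x ≡ x * x
    square-neg = trans (sym (-‿distribˡ-* x (- x)))
      (trans (cong -_ (sym (-‿distribʳ-* x x))) (-‿involutive (x * x)))

  0≤x*x : ∀ x → 0ℝ ≤ x * x
  0≤x*x x with x ≟ℝ 0ℝ
  ... | yes refl = inj₂ (sym (zeroˡ _))
  ... | no x≢0   = inj₁ (0<x*x x≢0)

  0<+ˡ : ∀ {x y} → 0ℝ < x → 0ℝ ≤ y → 0ℝ < x + y
  0<+ˡ {x} {y} 0<x (inj₁ 0<y)  = <-trans 0<y (subst (_< x + y) (+-identityˡ y) (+-mono-< y 0<x))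
  0<+ˡ {x}     0<x (inj₂ refl) = subst (0ℝ <_) (sym (+-identityʳ x)) 0<x

  0≤+ : ∀ {x y} → 0ℝ ≤ x → 0ℝ ≤ y → 0ℝ ≤ x + y
  0≤+ (inj₁ 0<x)        0≤y = inj₁ (0<+ˡ 0<x 0≤y)
  0≤+ {y = y} (inj₂ refl) 0≤y = subst (0ℝ ≤_) (sym (+-identityˡ y)) 0≤y

  0<+ʳ : ∀ {x y} → 0ℝ ≤ x → 0ℝ < y → 0ℝ < x + y
  0<+ʳ {x} {y} 0≤x 0<y = subst (0ℝ <_) (CommutativeRing.+-comm ring y x) (0<+ˡ 0<y 0≤x)

  -- Finite sums of reals.

  Σℝ : ∀ {n} → (Fin n → ℝ) → ℝ
  Σℝ = sumFin R

  Σ≡sum : ∀ {n} (f : Fin n → ℝ) → Σℝ f ≡ sum f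
  Σ≡sum {zero}  f = refl
  Σ≡sum {suc n} f = cong (f fz +_) (Σ≡sum (f ∘ fs))

  Σ-cong : ∀ {n} {f g : Fin n → ℝ} → (∀ k → f k ≡ g k) → Σℝ f ≡ Σℝ g
  Σ-cong {f = f} {g} eq = trans (Σ≡sum f) (trans (sum-cong-≗ eq) (sym (Σ≡sum g)))

  Σ-*ˡ : ∀ {n} x (f : Fin n → ℝ) → x * Σℝ f ≡ Σℝ (λ k → x * f k)
  Σ-*ˡ {n} x f = trans (cong (x *_) (Σ≡sum f)) (trans (*-distribˡ-sum x f) (sym (Σ≡sum {n} _)))

  Σ-*ʳ : ∀ {n} x (f : Fin n → ℝ) → Σℝ f * x ≡ Σℝ (λ k → f k * x)
  Σ-*ʳ {n} x f = trans (cong (_* x) (Σ≡sum f)) (trans (*-distribʳ-sum x f) (sym (Σ≡sum {n} _)))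

  Σ-+ : ∀ {n} (f g : Fin n → ℝ) → Σℝ (λ k → f k + g k) ≡ Σℝ f + Σℝ g
  Σ-+ {n} f g = trans (Σ≡sum {n} _) (trans (∑-distrib-+ {n} f g) (sym (cong₂ _+_ (Σ≡sum f) (Σ≡sum g))))

  Σ-comm : ∀ {m n} (f : Fin m → Fin n → ℝ) →
    Σℝ (λ i → Σℝ (f i)) ≡ Σℝ (λ j → Σℝ (λ i → f i j))
  Σ-comm {m} {n} f = begin
    Σℝ (λ i → Σℝ (f i))            ≡⟨ Σ-cong (λ i → Σ≡sum (f i)) ⟩
    Σℝ (λ i → sum (f i))           ≡⟨ Σ≡sum {m} _ ⟩
    sum (λ i → sum (f i))          ≡⟨ ∑-comm f ⟩
    sum (λ j → sum (λ i → f i j))  ≡⟨ sym (Σ≡sum {n} _) ⟩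
    Σℝ (λ j → sum (λ i → f i j))   ≡⟨ Σ-cong {n} (λ j → sym (Σ≡sum {m} _)) ⟩
    Σℝ (λ j → Σℝ (λ i → f i j))    ∎
    where open ≡-Reasoning

  Σ-zero : ∀ {n} {f : Fin n → ℝ} → (∀ k → f k ≡ 0ℝ) → Σℝ f ≡ 0ℝ
  Σ-zero {n} {f} eq = trans (Σ≡sum f) (trans (sum-cong-≗ eq) (sum-replicate-zero n))

  Σ-remove : ∀ {n} p (f : Fin (suc n) → ℝ) → Σℝ f ≡ f p + Σℝ (f ∘ punchIn p)
  Σ-remove {n} p f = trans (Σ≡sum f) (trans (sum-remove {i = p} f) (cong (f p +_) (sym (Σ≡sum {n} _))))

  Σ-only : ∀ {n} p (f : Fin n → ℝ) → (∀ k → k ≢ p → f k ≡ 0ℝ) → Σℝ f ≡ f p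
  Σ-only {suc n} p f eq = trans (Σ-remove p f)
    (trans (cong (f p +_) (Σ-zero (λ k → eq _ (punchInᵢ≢i p k)))) (+-identityʳ (f p)))

  -- The source of second neighbours: applied to an entry of a matrix product, it yields another
  -- path of length two between the same vertices.
  Σ-other : ∀ {n} p (f : Fin n → ℝ) → Σℝ f ≢ f p → ∃[ k ] (k ≢ p × f k ≢ 0ℝ)
  Σ-other p f ne with any? (λ k → ¬? (k ≟ p) ×-dec ¬? (f k ≟ℝ 0ℝ))
  ... | yes found = found
  ... | no none   = contradiction (Σ-only p f (λ k k≢p → stable (λ fk≢0 → none (k , k≢p , fk≢0)))) ne

  0≤Σ-sq : ∀ {n} (f : Fin n → ℝ) → 0ℝ ≤ Σℝ (λ k → f k * f k)
  0≤Σ-sq {zero}  f = inj₂ refl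
  0≤Σ-sq {suc n} f = 0≤+ (0≤x*x (f fz)) (0≤Σ-sq (f ∘ fs))

  0<Σ-sq : ∀ {n} (f : Fin n → ℝ) k → f k ≢ 0ℝ → 0ℝ < Σℝ (λ k → f k * f k)
  0<Σ-sq f fz     ne = 0<+ˡ (0<x*x ne) (0≤Σ-sq (f ∘ fs))
  0<Σ-sq f (fs k) ne = 0<+ʳ (0≤x*x (f fz)) (0<Σ-sq (f ∘ fs) k ne)

  Σ-sq≡0 : ∀ {n} (f : Fin n → ℝ) → Σℝ (λ k → f k * f k) ≡ 0ℝ → ∀ k → f k ≡ 0ℝ
  Σ-sq≡0 f eq k = stable λ ne → <-irrefl (sym eq) (0<Σ-sq f k ne)

  Σ-sq-single : ∀ {n} (f : Fin n → ℝ) s → Σℝ (λ k → f k * f k) ≡ f s * f s →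
    ∀ k → k ≢ s → f k ≡ 0ℝ
  Σ-sq-single {suc n} f s eq k k≢s =
    subst (λ k → f k ≡ 0ℝ) (punchIn-punchOut (k≢s ∘ sym)) (Σ-sq≡0 (f ∘ punchIn s) rest≡0 _)
    where
    rest≡0 : Σℝ (λ k → f (punchIn s k) * f (punchIn s k)) ≡ 0ℝ
    rest≡0 = +-identityʳ-unique _ _ (trans (sym (Σ-remove s (λ k → f k * f k))) eq)

  -- Matrix products.

  infixl 7 _⊠_
  infix 4 _≈_

  _⊠_ : ∀ {n} → Mat R n → Mat R n → Mat R n
  _⊠_ = _·_ R

  _≈_ : ∀ {n} → Mat R n → Mat R n → Set
  _≈_ = _≐_ R

  ⊠-congˡ : ∀ {n} (A : Mat R n) {B C : Mat R n} → B ≈ C → A ⊠ B ≈ A ⊠ C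
  ⊠-congˡ {n} A eq i j = Σ-cong {n} λ k → cong (A i k *_) (eq k j)

  ⊠-congʳ : ∀ {n} (C : Mat R n) {A B : Mat R n} → A ≈ B → A ⊠ C ≈ B ⊠ C
  ⊠-congʳ {n} C eq i j = Σ-cong {n} λ k → cong (_* C k j) (eq i k)

  ⊠-assoc : ∀ {n} (A B C : Mat R n) → (A ⊠ B) ⊠ C ≈ A ⊠ (B ⊠ C)
  ⊠-assoc {n} A B C i j = begin
    Σℝ (λ k → Σℝ (λ l → A i l * B l k) * C k j)    ≡⟨ Σ-cong {n} (λ k → Σ-*ʳ {n} (C k j) _) ⟩
    Σℝ (λ k → Σℝ (λ l → A i l * B l k * C k j))    ≡⟨ Σ-comm (λ k l → A i l * B l k * C k j) ⟩
    Σℝ (λ l → Σℝ (λ k → A i l * B l k * C k j))    ≡⟨ Σ-cong {n} (λ l → Σ-cong {n} (λ k → *-assoc _ _ _)) ⟩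
    Σℝ (λ l → Σℝ (λ k → A i l * (B l k * C k j)))  ≡⟨ Σ-cong {n} (λ l → sym (Σ-*ˡ {n} (A i l) _)) ⟩
    Σℝ (λ l → A i l * Σℝ (λ k → B l k * C k j))    ∎
    where open ≡-Reasoning

  idMat-diag : ∀ {n} (i : Fin n) → idMat R i i ≡ 1ℝ
  idMat-diag i with i ≟ i
  ... | yes _  = refl
  ... | no i≢i = contradiction refl i≢i

  idMat-off : ∀ {n} {i j : Fin n} → i ≢ j → idMat R i j ≡ 0ℝ
  idMat-off {i = i} {j} i≢j with i ≟ j
  ... | yes i≡j = contradiction i≡j i≢j
  ... | no _    = refl

  ⊠-identityʳ : ∀ {n} (A : Mat R n) → A ⊠ idMat R ≈ A
  ⊠-identityʳ {n} A i j = trans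
    (Σ-only j _ (λ k k≢j → trans (cong (A i k *_) (idMat-off k≢j)) (zeroʳ _)))
    (trans (cong (A i j *_) (idMat-diag j)) (*-identityʳ _))

  -- Kernel vectors and the projection P = AX.

  Kernel : ∀ {n} → Mat R n → (Fin n → ℝ) → Set
  Kernel A z = ∀ i → Σℝ (λ k → A i k * z k) ≡ 0ℝ

  module GroupInverse {n : ℕ} {A X : Mat R n} (inv : IsGroupInverse R A X) where

    P : Mat R n
    P = A ⊠ X

    PA : P ⊠ A ≈ A
    PA = proj₁ inv

    P-comm : P ≈ X ⊠ A
    P-comm = proj₂ (proj₂ inv)

    XP : X ⊠ P ≈ X
    XP i j = trans (sym (⊠-assoc X A X i j)) (proj₁ (proj₂ inv) i j)

    AP : A ⊠ P ≈ A
    AP i j = trans (⊠-congˡ A P-comm i j) (trans (sym (⊠-assoc A X A i j)) (PA i j))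

    -- If P = I, then `X` inverts `A`. Otherwise I - P has a nonzero column, and `A` annihilates it
    -- because AP = A.
    singular⇒kernel : Singular R A → ∃[ z ] (Kernel A z × ∃[ s ] z s ≢ 0ℝ)
    singular⇒kernel sing with any? (λ t → any? (λ s → ¬? (P s t ≟ℝ idMat R s t)))
    ... | no none = ⊥-elim (sing (X , P≈I , λ i j → trans (sym (P-comm i j)) (P≈I i j)))
      where
      P≈I : P ≈ idMat R
      P≈I s t = stable λ ne → none (t , s , ne)
    ... | yes (t , s , ne) = z , ker , s , λ zs≡0 → ne (sym (x∙y⁻¹≈ε⇒x≈y _ _ zs≡0))
      where
      open ≡-Reasoning
      z : Fin n → ℝ
      z k = idMat R k t + - P k t
      ker : Kernel A z
      ker i = begin
        Σℝ (λ k → A i k * z k)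
          ≡⟨ Σ-cong {n} (λ k → distribˡ (A i k) _ _) ⟩
        Σℝ (λ k → A i k * idMat R k t + A i k * - P k t)
          ≡⟨ Σ-+ {n} _ _ ⟩
        (A ⊠ idMat R) i t + Σℝ (λ k → A i k * - P k t)
          ≡⟨ cong₂ _+_ (⊠-identityʳ A i t) (Σ-cong {n} λ k →
               trans (sym (-‿distribʳ-* (A i k) (P k t))) (-≡-1* (A i k * P k t))) ⟩
        A i t + Σℝ (λ k → - 1ℝ * (A i k * P k t))
          ≡⟨ cong (A i t +_) (trans (sym (Σ-*ˡ {n} (- 1ℝ) _))
               (trans (cong (- 1ℝ *_) (AP i t)) (sym (-≡-1* (A i t))))) ⟩
        A i t + - A i t
          ≡⟨ -‿inverseʳ (A i t) ⟩
        0ℝ ∎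
        where
        -≡-1* : ∀ x → - x ≡ - 1ℝ * x
        -≡-1* x = trans (cong -_ (sym (*-identityˡ x))) (-‿distribˡ-* 1ℝ x)

    module _ (A-sym : ∀ i j → A i j ≡ A j i) where

      A-Pᵀ : ∀ i j → Σℝ (λ k → A i k * P j k) ≡ A i j
      A-Pᵀ i j = trans (Σ-cong {n} λ k → trans (*-comm _ _) (cong (P j k *_) (A-sym i k)))
        (trans (PA j i) (A-sym j i))

      -- P = XA = X(APᵀ) = PPᵀ.
      P≡PPᵀ : ∀ i j → P i j ≡ Σℝ (λ k → P i k * P j k)
      P≡PPᵀ i j = begin
        P i j                                         ≡⟨ P-comm i j ⟩
        Σℝ (λ l → X i l * A l j)                      ≡⟨ Σ-cong {n} (λ l → cong (X i l *_) (sym (A-Pᵀ l j))) ⟩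
        (X ⊠ (A ⊠ (λ k j → P j k))) i j               ≡⟨ sym (⊠-assoc X A (λ k j → P j k) i j) ⟩
        ((X ⊠ A) ⊠ (λ k j → P j k)) i j               ≡⟨ Σ-cong {n} (λ k → cong (_* P j k) (sym (P-comm i k))) ⟩
        Σℝ (λ k → P i k * P j k)                      ∎
        where open ≡-Reasoning

      P-sym : ∀ i j → P i j ≡ P j i
      P-sym i j = trans (P≡PPᵀ i j) (trans (Σ-cong {n} λ k → *-comm _ _) (sym (P≡PPᵀ j i)))

      P-kernel : ∀ {z} → Kernel A z → ∀ i → Σℝ (λ k → P i k * z k) ≡ 0ℝ
      P-kernel {z} ker i = trans (Σ-cong {n} λ k → cong (_* z k) (P-comm i k))
        (trans (⊠-assoc X A (λ k _ → z k) i i)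
        (Σ-zero {n} λ l → trans (cong (X i l *_) (ker l)) (zeroʳ _)))

      -- `P i i` is the sum of squares of row i of `P`. If it vanishes, so does that row, and with
      -- it row i of A = PA.
      P-diag≢0 : ∀ {i j} → A i j ≢ 0ℝ → P i i ≢ 0ℝ
      P-diag≢0 {i} {j} Aij≢0 Pii≡0 = Aij≢0 (trans (sym (PA i j))
        (Σ-zero {n} λ k → trans (cong (_* A k j) (Σ-sq≡0 (P i) (trans (sym (P≡PPᵀ i i)) Pii≡0) k)) (zeroˡ _)))

      -- If `P i i` is 1, the sum of squares of row i is used up by the diagonal entry. Then entry i
      -- of Pz is a nonzero multiple of `z i`, while Pz = XAz = 0.
      P-diag≢1 : ∀ {z i} → Kernel A z → z i ≢ 0ℝ → P i i ≢ 1ℝ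
      P-diag≢1 {z} {i} ker zi≢0 Pii≡1 = ≢0-* (λ Pii≡0 → 0≢1 (trans (sym Pii≡0) Pii≡1)) zi≢0
        (trans (sym (Σ-only i _ λ k k≢i → trans (cong (_* z k) (off k k≢i)) (zeroˡ _))) (P-kernel ker i))
        where
        off : ∀ k → k ≢ i → P i k ≡ 0ℝ
        off = Σ-sq-single (P i) i (trans (sym (P≡PPᵀ i i))
          (trans (sym (*-identityʳ _)) (cong (P i i *_) (sym Pii≡1))))

  -- Kernel vectors of a weighted tree.

  module _ {n : ℕ} {A : Mat R n} (tree : IsWeightedTree R A) where

    private
      G : Graph n
      G = graphOf R A
      T : IsTree G
      T = proj₂ tree
      A-sym : ∀ i j → A i j ≡ A j i
      A-sym = proj₁ tree

    open IsTree T using (nonempty) renaming (symmetric to G-sym; irreflexive to G-irr)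
    open Tree T
    open Matching T
    open import Data.List.Membership.DecPropositional (_≟_ {n}) using (_∈?_)

    edge? : ∀ i j → Dec (G i j)
    edge? i j = ¬? (A i j ≟ℝ 0ℝ)

    kernel-neighbour : ∀ {z} → Kernel A z → ∀ {i p} → G i p → z p ≢ 0ℝ →
      ∃[ k ] (k ≢ p × G k i × z k ≢ 0ℝ)
    kernel-neighbour {z} ker {i} {p} ip zp≢0
      with Σ-other p (λ k → A i k * z k) (λ eq → ≢0-* ip zp≢0 (trans (sym eq) (ker i)))
    ... | k , k≢p , ne = k , k≢p , G-sym _ _ (proj₁ (≢0-*⁻ ne)) , proj₂ (≢0-*⁻ ne)

    perfect⇒no-kernel : ∀ {M} → IsMatching G M → (∀ i → i ∈ endpoints M) →
      ∀ {z} → Kernel A z → ∀ s → z s ≡ 0ℝ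
    perfect⇒no-kernel {M} mt@(_ , uq) perfect {z} ker s = stable nonzero
      where
      -- The ray alternates. A step outside `M` ends at a vertex where `z` is nonzero and is
      -- followed by its matching edge; after a matching edge the kernel equation supplies the next
      -- vertex with `z` nonzero.
      Ray : Fin n → Fin n → Set
      Ray k p = (z k ≢ 0ℝ × ¬ InM M k p) ⊎ (InM M k p × z p ≢ 0ℝ)
      next : ∀ k p → G k p → Ray k p → ∃[ k′ ] (k′ ≢ p × G k′ k × Ray k′ k)
      next k p kp (inj₁ (zk≢0 , ¬kp)) with covered⇒partner {M = M} (perfect k)
      ... | k′ , kk′ = k′ , (λ { refl → ¬kp kk′ }) , InM⇒edge mt (InM-sym {M = M} kk′)
                     , inj₂ (InM-sym {M = M} kk′ , zk≢0)
      next k p kp (inj₂ (m , zp≢0)) with kernel-neighbour ker kp zp≢0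
      ... | k′ , k′≢p , e , zk′≢0 = k′ , k′≢p , e
                     , inj₁ (zk′≢0 , λ m′ → k′≢p (partner-unique uq (InM-sym {M = M} m′) m))
      nonzero : ¬ z s ≢ 0ℝ
      nonzero zs≢0 with covered⇒partner {M = M} (perfect s)
      ... | p , sp = no-ray Ray next p s (InM⇒edge mt (InM-sym {M = M} sp)) (inj₂ (InM-sym {M = M} sp , zs≢0))

    Leaf : Fin n → Fin n → Set
    Leaf s v = G s v × (∀ j → G s j → j ≡ v)

    -- With no leaf in the support of `z`, a ray never stops: a support vertex has a second edge to
    -- leave by, and a vertex entered from the support has a second support neighbour by the kernel
    -- equation.
    kernel-leaf : ∀ {z} → Kernel A z → ∀ {s p} → z s ≢ 0ℝ → G s p →
      ∃[ l ] ∃[ v ] (z l ≢ 0ℝ × Leaf l v)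
    kernel-leaf {z} ker {s} {p} zs≢0 sp
      with any? (λ l → any? λ v →
             ¬? (z l ≟ℝ 0ℝ) ×-dec edge? l v ×-dec all? (λ j → edge? l j →-dec (j ≟ v)))
    ... | yes found = found
    ... | no none   = ⊥-elim (no-ray Ray next s p sp (inj₁ zs≢0))
      where
      Ray : Fin n → Fin n → Set
      Ray k p = z k ≢ 0ℝ ⊎ z p ≢ 0ℝ
      next : ∀ k p → G k p → Ray k p → ∃[ k′ ] (k′ ≢ p × G k′ k × Ray k′ k)
      next k p kp (inj₁ zk≢0) with any? (λ k′ → ¬? (k′ ≟ p) ×-dec edge? k′ k)
      ... | yes (k′ , k′≢p , e) = k′ , k′≢p , e , inj₂ zk≢0
      ... | no only = contradiction (k , p , zk≢0 , kp ,
        λ j kj → decidable-stable (j ≟ p) λ j≢p → only (j , j≢p , G-sym _ _ kj)) none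
      next k p kp (inj₂ zp≢0) with kernel-neighbour ker kp zp≢0
      ... | k′ , k′≢p , e , zk′≢0 = k′ , k′≢p , e , inj₁ zk′≢0

    isolated⇒star : ∀ s → ¬ (∃[ p ] G s p) → IsStar G
    isolated⇒star s none = near⇒star s λ k j sk _ → contradiction (k , sk) none

    -- Reaching a star from T# or from the path count.

    module _ {X : Mat R n} (inv : IsGroupInverse R A X) where
      open GroupInverse inv

      leaf-row : ∀ {s v} → Leaf s v → ∀ j → P s j ≡ A s v * X v j
      leaf-row {s} {v} (_ , only) j = Σ-only v _ λ k k≢v →
        trans (cong (_* X k j) (stable λ sk → k≢v (only k sk))) (zeroˡ _)

      -- In entry (j, s) of XP = X, the factor `P s s ≢ 1` prevents the term at `s` from being the
      -- whole sum. Another nonzero term, at `i`, makes `v`, `s`, `j`, `i` a square of T#; symmetry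
      -- of `P` and `leaf-row` give the side `v i`.
      inverse-leaf : Squarefree (graphOf R X) → ∀ {z} → Kernel A z → ∀ {s v} → z s ≢ 0ℝ → Leaf s v →
        ∀ j → X s j ≢ 0ℝ → j ≡ v
      inverse-leaf sq {z} ker {s} {v} zs≢0 leaf@(sv , _) j sj = decidable-stable (j ≟ v) square-at
        where
        open Squarefree sq using (symmetric) renaming (no-square to X-no-square)
        vs : X v s ≢ 0ℝ
        vs = proj₂ (≢0-*⁻ (P-diag≢0 A-sym sv ∘ trans (leaf-row leaf s)))
        js : X j s ≢ 0ℝ
        js = symmetric sj
        XPss≢Xjs : X j s * P s s ≢ X j s
        XPss≢Xjs eq = P-diag≢1 A-sym ker zs≢0 (cancel js (trans eq (sym (*-identityʳ _))))
          where
          cancel : ∀ {x y w} → x ≢ 0ℝ → x * y ≡ x * w → y ≡ w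
          cancel {x} {y} {w} x≢0 xy≡xw = x∙y⁻¹≈ε⇒x≈y y w (stable λ d≢0 → ≢0-* x≢0 d≢0
            (trans (distribˡ x y (- w)) (trans (cong (x * y +_) (sym (-‿distribʳ-* x w)))
              (trans (cong (λ u → u + - (x * w)) xy≡xw) (-‿inverseʳ _)))))
        close : j ≢ v → ∃[ i ] (i ≢ s × X j i * P i s ≢ 0ℝ) → ⊥
        close j≢v (i , i≢s , ne) = X-no-square (j≢v ∘ sym) (i≢s ∘ sym) vs sj ji (symmetric vi)
          where
          ji : X j i ≢ 0ℝ
          ji = proj₁ (≢0-*⁻ ne)
          Psi≢0 : P s i ≢ 0ℝ
          Psi≢0 eq = proj₂ (≢0-*⁻ ne) (trans (P-sym A-sym i s) eq)
          vi : X v i ≢ 0ℝ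
          vi = proj₂ (≢0-*⁻ (λ eq → Psi≢0 (trans (leaf-row leaf i) eq)))
        square-at : ¬ j ≢ v
        square-at j≢v = close j≢v
          (Σ-other s (λ k → X j k * P k s) (λ eq → XPss≢Xjs (trans (sym eq) (XP j s))))

      -- Rows v of A and X have the same support and P v j = 0 for j ≢ v, so a
      -- vertex j at distance two from v would lie on a second path of length two.
      common-leaf⇒star : ∀ {s v} → Leaf s v → (∀ j → X s j ≢ 0ℝ → j ≡ v) → IsStar G
      common-leaf⇒star {s} {v} leaf@(sv , only) X-only = near⇒star v near
        where
        leaf-row′ : ∀ j → P s j ≡ X s v * A v j
        leaf-row′ j = trans (P-comm s j) (Σ-only v _ λ k k≢v →
          trans (cong (_* A k j) (stable λ sk → k≢v (X-only k sk))) (zeroˡ _))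
        X-sv : X s v ≢ 0ℝ
        X-sv = proj₁ (≢0-*⁻ (P-diag≢0 A-sym sv ∘ trans (leaf-row′ s)))
        -- `P s k` equals both `A s v * X v k` and `X s v * A v k`, and the factors `A s v`, `X s v`
        -- are nonzero.
        A⇒X : ∀ {k} → G v k → X v k ≢ 0ℝ
        A⇒X {k} vk = proj₂ (≢0-*⁻ (≢0-* X-sv vk ∘ trans (sym (leaf-row′ k)) ∘ trans (leaf-row leaf k)))
        X⇒A : ∀ {k} → X v k ≢ 0ℝ → G v k
        X⇒A {k} vk = proj₂ (≢0-*⁻ (≢0-* sv vk ∘ trans (sym (leaf-row leaf k)) ∘ trans (leaf-row′ k)))
        P-off : ∀ j → j ≢ v → P v j ≡ 0ℝ
        P-off j j≢v = stable λ Pvj≢0 → ≢0-* sv Pvj≢0 (begin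
          A s v * P v j                ≡⟨ sym (Σ-only v (λ k → A s k * P k j) λ k k≢v →
                                            trans (cong (_* P k j) (stable λ sk → k≢v (only k sk))) (zeroˡ _)) ⟩
          (A ⊠ P) s j                  ≡⟨ AP s j ⟩
          A s j                        ≡⟨ stable (λ sj → j≢v (only j sj)) ⟩
          0ℝ                           ∎)
          where open ≡-Reasoning
        close : ∀ {k j} → G v k → G k j → j ≢ v → ∃[ k′ ] (k′ ≢ k × X v k′ * A k′ j ≢ 0ℝ) → ⊥
        close vk kj j≢v (k′ , k′≢k , ne) = no-square (j≢v ∘ sym) (k′≢k ∘ sym) vk kj
          (G-sym _ _ (proj₂ (≢0-*⁻ ne))) (G-sym _ _ (X⇒A (proj₁ (≢0-*⁻ ne))))
        near : ∀ k j → G v k → G k j → j ≡ v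
        near k j vk kj = decidable-stable (j ≟ v) λ j≢v → close vk kj j≢v
          (Σ-other k (λ k → X v k * A k j) (λ eq → ≢0-* (A⇒X vk) kj
            (trans (sym eq) (trans (sym (P-comm v j)) (P-off j j≢v)))))

      squarefree⇒star : Singular R A → Squarefree (graphOf R X) → IsStar G
      squarefree⇒star sing sq with singular⇒kernel sing
      ... | z , ker , s , zs≢0 with any? (edge? s)
      ...   | no none      = isolated⇒star s none
      ...   | yes (p , sp) with kernel-leaf ker zs≢0 sp
      ...     | l , v , zl≢0 , leaf = common-leaf⇒star leaf (inverse-leaf sq ker zl≢0 leaf)

      paths⇒star : Singular R A → NumAlternatingPaths≡ G (n ∸ 1) → IsStar G
      -- An empty list forces n = 1.
      paths⇒star sing paths@([] , _ , len , _) = single nonempty (sym len)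
        where
        single : ∀ {n} {G : Graph n} → 1 ≤ℕ n → n ∸ 1 ≡ 0 → IsStar G
        single {suc zero} _ _ = fz , λ { fz fz _ → inj₁ refl }
      paths⇒star sing paths@((a , b) ∷ ps , _ , _ , alt) with singular⇒kernel sing
      -- A listed path brings a maximum matching with it, so none has to be constructed; the kernel
      -- vector shows that it is not perfect.
      ... | z , ker , s , zs≢0 with proj₂ (Equivalence.to (alt a b) (here refl))
      ...   | M , _ , mx , _ with all? (λ i → i ∈? endpoints M)
      ...     | yes perfect = contradiction (perfect⇒no-kernel (proj₁ mx) perfect ker s) zs≢0
      ...     | no exposed with ¬∀⟶∃¬ n _ (λ i → i ∈? endpoints M) exposed
      ...       | u , u∉ with any? (edge? u)
      ...         | no none      = isolated⇒star u none
      ...         | yes (v , uv) = squareless⇒star (too-few-paths⇒squareless T mx paths) mx u∉ uv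

      -- The group inverse of a star.

      module _ (star : IsStar G) where
        private
          c = proj₁ star
          q = (A ⊠ A) c c

        star-nonedge : ∀ {i j} → i ≢ c → j ≢ c → A i j ≡ 0ℝ
        star-nonedge i≢c j≢c = stable λ ij → Sum.[ i≢c , j≢c ]′ (proj₂ star _ _ ij)

        centre-loop : A c c ≡ 0ℝ
        centre-loop = stable (G-irr c)

        star-square-centre : ∀ {j} → j ≢ c → (A ⊠ A) c j ≡ 0ℝ
        star-square-centre {j} j≢c = Σ-zero {n} λ k → term k
          where
          term : ∀ k → A c k * A k j ≡ 0ℝ
          term k with k ≟ c
          ... | yes refl = trans (cong (_* A c j) centre-loop) (zeroˡ _)
          ... | no k≢c   = trans (cong (A c k *_) (star-nonedge k≢c j≢c)) (zeroʳ _)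

        star-square-leaves : ∀ {i j} → i ≢ c → (A ⊠ A) i j ≡ A i c * A c j
        star-square-leaves {i} {j} i≢c = Σ-only c (λ k → A i k * A k j) λ k k≢c →
          trans (cong (_* A k j) (star-nonedge i≢c k≢c)) (zeroˡ _)

        -- From `i ≢ c` the only step leads to `c`, and row `c` of the square of `A` is zero except
        -- for `q` on the diagonal. From `c` itself, each term contains the common factor `A c j`,
        -- and the remaining sum is `q`.
        star-cube : ∀ i j → (A ⊠ (A ⊠ A)) i j ≡ q * A i j
        star-cube i j with i ≟ c | j ≟ c
        ... | no i≢c | yes refl = trans (Σ-only c _ λ k k≢c →
                trans (cong (_* (A ⊠ A) k c) (star-nonedge i≢c k≢c)) (zeroˡ _)) (*-comm _ _)
        ... | no i≢c | no j≢c = trans (Σ-only c _ λ k k≢c →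
                trans (cong (_* (A ⊠ A) k j) (star-nonedge i≢c k≢c)) (zeroˡ _))
                (trans (trans (cong (A i c *_) (star-square-centre j≢c)) (zeroʳ _))
                (sym (trans (cong (q *_) (star-nonedge i≢c j≢c)) (zeroʳ _))))
        ... | yes refl | _ = trans (Σ-cong {n} term) (sym (Σ-*ʳ {n} (A c j) (λ k → A c k * A k c)))
          where
          term : ∀ k → A c k * (A ⊠ A) k j ≡ A c k * A k c * A c j
          term k with k ≟ c
          ... | yes refl = trans (trans (cong (_* q′) centre-loop) (zeroˡ _))
                  (sym (trans (cong (λ x → x * A c c * A c j) centre-loop)
                    (trans (cong (_* A c j) (zeroˡ _)) (zeroˡ _))))
            where q′ = (A ⊠ A) c j
          ... | no k≢c = trans (cong (A c k *_) (star-square-leaves k≢c)) (sym (*-assoc _ _ _))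

        -- X = X²A, so A = A²X = XA² = X²A³ = qX²A = qX.
        star-inverse : ∀ i j → A i j ≡ q * X i j
        star-inverse i j = begin
          A i j                        ≡⟨ sym (PA i j) ⟩
          (P ⊠ A) i j                  ≡⟨ ⊠-congʳ A P-comm i j ⟩
          ((X ⊠ A) ⊠ A) i j            ≡⟨ ⊠-assoc X A A i j ⟩
          (X ⊠ (A ⊠ A)) i j            ≡⟨ ⊠-congʳ (A ⊠ A) (λ k l → sym (XXA k l)) i j ⟩
          ((X ⊠ (X ⊠ A)) ⊠ (A ⊠ A)) i j  ≡⟨ ⊠-assoc X (X ⊠ A) (A ⊠ A) i j ⟩
          (X ⊠ ((X ⊠ A) ⊠ (A ⊠ A))) i j  ≡⟨ ⊠-congˡ X (⊠-assoc X A (A ⊠ A)) i j ⟩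
          (X ⊠ (X ⊠ (A ⊠ (A ⊠ A)))) i j  ≡⟨ ⊠-congˡ X (⊠-congˡ X star-cube) i j ⟩
          (X ⊠ (X ⊠ qA)) i j             ≡⟨ ⊠-congˡ X (scale X A) i j ⟩
          (X ⊠ (λ k l → q * (X ⊠ A) k l)) i j  ≡⟨ scale X (X ⊠ A) i j ⟩
          q * (X ⊠ (X ⊠ A)) i j          ≡⟨ cong (q *_) (XXA i j) ⟩
          q * X i j                      ∎
          where
          open ≡-Reasoning
          qA : Mat R n
          qA k l = q * A k l
          XXA : X ⊠ (X ⊠ A) ≈ X
          XXA k l = trans (⊠-congˡ X (λ k l → sym (P-comm k l)) k l) (XP k l)
          scale : ∀ B C → B ⊠ (λ k l → q * C k l) ≈ (λ k l → q * (B ⊠ C) k l)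
          scale B C k l = trans (Σ-cong {n} λ m → trans (sym (*-assoc _ _ _))
            (trans (cong (_* C m l) (*-comm _ _)) (*-assoc _ _ _))) (sym (Σ-*ˡ {n} q _))

        star⇒edge : ∀ {i j} → G i j → X i j ≢ 0ℝ
        star⇒edge {i} {j} ij = proj₂ (≢0-*⁻ (ij ∘ trans (star-inverse i j)))

        star⇒edge⁻ : ∀ {i j} → X i j ≢ 0ℝ → G i j
        star⇒edge⁻ {i} {j} ij = ≢0-* q≢0 ij ∘ trans (sym (star-inverse i j))
          where
          -- For a single vertex `q` is 0, so the edge `ij` of T# has to enter: q = 0 gives A = 0,
          -- hence P = 0 and X = XP = 0.
          q≢0 : q ≢ 0ℝ
          q≢0 q≡0 = ij (trans (sym (XP i j)) (Σ-zero {n} λ k → trans (cong (X i k *_) (P≡0 k)) (zeroʳ _)))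
            where
            A≡0 : ∀ k l → A k l ≡ 0ℝ
            A≡0 k l = trans (star-inverse k l) (trans (cong (_* X k l) q≡0) (zeroˡ _))
            P≡0 : ∀ k → P k j ≡ 0ℝ
            P≡0 k = Σ-zero {n} λ l → trans (cong (_* X l j) (A≡0 k l)) (zeroˡ _)

-- The equivalences.

star⇒num-paths : ∀ {n} {G : Graph n} → IsTree G → IsStar G → NumAlternatingPaths≡ G (n ∸ 1)
star⇒num-paths {zero}  T star = contradiction (IsTree.nonempty T) λ ()
star⇒num-paths {suc m} T star = star⇒paths T star

theorem2p12 : (R : Reals) (n : ℕ) (A : Mat R n) → IsWeightedTree R A → Singular R A →
    (X : Mat R n) → IsGroupInverse R A X →
    (NumAlternatingPaths≡ (graphOf R A) (n ∸ 1) ⇔ IsTree (graphOf R X))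
    × (IsTree (graphOf R X) ⇔ IsStar (graphOf R A))
    × (IsStar (graphOf R A) ⇔ Isomorphic (graphOf R X) (graphOf R A))
theorem2p12 R n A tree@(_ , T) sing X inv =
    mk⇔ (star⇒tree ∘ paths⇒star R tree inv sing) (star⇒num-paths T ∘ tree⇒star)
  , mk⇔ tree⇒star star⇒tree
  -- For a star, T and T# have the same edges, so the identity is an isomorphism.
  , mk⇔ (λ star → ↔-id _ , λ i j → mk⇔ (star⇒edge⁻ R tree inv star) (star⇒edge R tree inv star))
        (λ iso → squarefree⇒star R tree inv sing (isomorphic-squarefree iso (tree⇒squarefree T)))
  where
  tree⇒star : IsTree (graphOf R X) → IsStar (graphOf R A)
  tree⇒star T# = squarefree⇒star R tree inv sing (tree⇒squarefree T#)
  star⇒tree : IsStar (graphOf R A) → IsTree (graphOf R X)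
  star⇒tree star = tree-resp-⇔ (star⇒edge R tree inv star) (star⇒edge⁻ R tree inv star) T
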